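{- For every (finite, simple) graph $G$, $$\chi_T(G) \le \Delta(G)+2\left\lceil \frac{|V(G)|}{\Delta(G)+1}\right\rceil .$$
   Context: A total coloring of a graph $G$ is an assignment of colors to the vertices and edges of $G$ such that adjacent vertices receive different colors, adjacent edges (edges sharing an endpoint) receive different colors, and every edge receives a color different from the colors of both of its endpoints. The total chromatic number $\chi_T(G)$ is the minimum number of colors in a total coloring of $G$. $\Delta(G)$ denotes the maximum degree of $G$. -}

module Defs where

open import Data.Nat using (ℕ; zero; suc; _+_; _≤_; _⊔_; _/_)
open import Data.Fin using (Fin)
open import Data.Bool using (Bool; true; false; T)
open import Data.List using (List; filter; length; map; foldr; allFin)
open import Data.Product using (Σ; _×_; _,_)
open import Relation.Nullary using (¬_)
open import Relation.Binary.PropositionalEquality using (_≡_; _≢_)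
open import Data.Bool.Properties using (T?)

record Graph (n : ℕ) : Set where
  field
    adj     : Fin n → Fin n → Bool
    sym     : ∀ u v → adj u v ≡ adj v u
    irrefl  : ∀ u → adj u u ≡ false

open Graph public

Adj : ∀ {n} → Graph n → Fin n → Fin n → Set
Adj G u v = T (adj G u v)

degree : ∀ {n} → Graph n → Fin n → ℕ
degree {n} G u = length (filter (λ v → T? (adj G u v)) (allFin n))

Δ : ∀ {n} → Graph n → ℕ
Δ {n} G = foldr _⊔_ 0 (map (degree G) (allFin n))

-- A total colouring of G with colours from Fin k.
-- Edge colours are given on ordered adjacent pairs and required to be
-- symmetric, so each (undirected) edge gets a single colour.
record TotalColoring {n : ℕ} (G : Graph n) (k : ℕ) : Set where
  field
    vcol : Fin n → Fin k
    ecol : (u v : Fin n) → Adj G u v → Fin k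
    ecol-sym : ∀ u v (p : Adj G u v) (q : Adj G v u) → ecol u v p ≡ ecol v u q
    vv : ∀ u v → Adj G u v → vcol u ≢ vcol v
    ee : ∀ u v w (p : Adj G u v) (q : Adj G u w) → v ≢ w → ecol u v p ≢ ecol u w q
    -- an edge gets a colour different from both its endpoints
    -- (the other endpoint is covered via ecol-sym)
    ve : ∀ u v (p : Adj G u v) → ecol u v p ≢ vcol u

TotallyColorable : ∀ {n} → Graph n → ℕ → Set
TotallyColorable G k = TotalColoring G k

-- χ_T(G) ≤ k  means there is a total colouring with at most k colours
-- (phrased directly; χ_T is the least such k).

ceilDivSuc : ℕ → ℕ → ℕ
ceilDivSuc a b = (a + b) / suc b

module Submission where

-- Put k = ⌈n/(Δ+1)⌉ and C = Δ + 2k. By the Hajnal–Szemerédi theorem (argument of Kierstead and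
-- Kostochka) the vertices have a proper colouring with classes of size at most k. The edges are then
-- coloured one at a time with Vizing fans. A Kempe chain may end at a vertex whose own colour is one
-- of the two chain colours α, β; all such vertices are merged into one hub, and swapping a union of
-- components exchanges the classes of α and β as a whole or not at all, so the vertex colouring stays
-- proper and bounded. By counting, some colour β is missing at 2k vertices of a maximal fan at v,
-- whereas the component of v has at most 2k ends, one of which is v: some fan vertex missing β lies
-- in another component, and a swap makes α missing both there and at v.

-- In ordinary edge colouring a Kempe chain ends only where a colour is missing. Here it may also
-- end at a vertex that itself bears `α` or `β`; recolouring that vertex alone could clash with
-- neighbours that the chain does not reach, which is why all such vertices move together. The price
-- is a component with many ends: in the component of the hub, `α` and `β` are missing at most as
-- often as there are vertices coloured `α` or `β`, and two classes of size at most `k` allow `2k`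
-- of these.
--
-- The number of colours pays this price. Every vertex misses at least `Δ + 2k - (Δ + 1) = 2k - 1`
-- colours, and the far end of the uncoloured edge misses one more. If no colour missing in a fan of
-- `s` vertices is missing at `v`, these colours are the colour of `v` or lie on the `s - 1`
-- coloured fan edges, so they number at most `s`. The mean exceeds `2k - 1`, some colour is missing
-- `2k` times, and the `α` missing at `v` is the unit that no longer fits.

open import Defs hiding (sym)
open import Data.Bool using () renaming (T to IsTrue)
import Data.Bool.Properties as Bool
open import Data.Empty using (⊥; ⊥-elim)
open import Data.Fin using (Fin; zero; suc; fromℕ<)
open import Data.Fin.Properties using (_≟_; any?; all?; suc-injective)
open import Data.List using (length; filter; tabulate; foldr)
open import Data.List.Properties using (map-tabulate)
open import Data.Nat hiding (_≟_)
open import Data.Nat.DivMod using (m≡m%n+[m/n]*n; m%n<n)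
open import Data.Nat.Induction using (<-wellFounded)
open import Data.Nat.Properties hiding (_≟_; ≡-irrelevant; suc-injective)
open import Data.Nat.Tactic.RingSolver using (solve-∀)
open import Data.Product
open import Data.Sum using (_⊎_; inj₁; inj₂; [_,_]′)
import Data.Sum as Sum
open import Data.Unit using (⊤; tt)
open import Function using (_∘_; id)
open import Induction.WellFounded using (Acc; acc)
open import Relation.Binary.PropositionalEquality
open import Relation.Nullary hiding (T?)
open import Relation.Nullary.Decidable using (decidable-stable; _×-dec_; _⊎-dec_; _→-dec_; ¬?; toSum)
open import Relation.Unary using (Decidable)
import Algebra.Properties.Semiring.Sum +-*-semiring as ∑

-- Finite sums and cardinalities of decidable subsets.

-- Abstract, so that the summand can be inferred by unification.
abstract
  sum : ∀ {n} → (Fin n → ℕ) → ℕ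
  sum = ∑.sum

  sum-cong : ∀ {n} {f g : Fin n → ℕ} → (∀ i → f i ≡ g i) → sum f ≡ sum g
  sum-cong = ∑.sum-cong-≗

  sum-+ : ∀ {n} (f g : Fin n → ℕ) → sum (λ i → f i + g i) ≡ sum f + sum g
  sum-+ = ∑.∑-distrib-+

  sum-swap : ∀ {m n} (f : Fin m → Fin n → ℕ) → sum (λ i → sum (f i)) ≡ sum (λ j → sum (λ i → f i j))
  sum-swap = ∑.∑-comm

  sum-*ˡ : ∀ {n} c (f : Fin n → ℕ) → sum (λ i → c * f i) ≡ c * sum f
  sum-*ˡ c f = sym (∑.*-distribˡ-sum c f)

  sum-0 : ∀ n → sum {n} (λ _ → 0) ≡ 0
  sum-0 = ∑.sum-replicate-zero

  sum-mono-≤ : ∀ {n} {f g : Fin n → ℕ} → (∀ i → f i ≤ g i) → sum f ≤ sum g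
  sum-mono-≤ {zero}  h = z≤n
  sum-mono-≤ {suc n} h = +-mono-≤ (h zero) (sum-mono-≤ (h ∘ suc))

  sum-mono-< : ∀ {n} {f g : Fin n → ℕ} i → (∀ j → f j ≤ g j) → f i < g i → sum f < sum g
  sum-mono-< zero    h lt = +-mono-<-≤ lt (sum-mono-≤ (h ∘ suc))
  sum-mono-< (suc i) h lt = +-mono-≤-< (h zero) (sum-mono-< i (h ∘ suc) lt)

  sum-const : ∀ n c → sum {n} (λ _ → c) ≡ n * c
  sum-const zero    c = refl
  sum-const (suc n) c = cong (c +_) (sum-const n c)

  term≤sum : ∀ {n} (f : Fin n → ℕ) i → f i ≤ sum f
  term≤sum f zero    = m≤m+n _ _
  term≤sum f (suc i) = ≤-trans (term≤sum (f ∘ suc) i) (m≤n+m _ _)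

  sum-δ : ∀ {n} (j : Fin n) (f : Fin n → ℕ) → (∀ i → i ≢ j → f i ≡ 0) → sum f ≡ f j
  sum-δ {suc n} zero f h =
    trans (cong (f zero +_) (trans (sum-cong (λ i → h (suc i) (λ ()))) (sum-0 n))) (+-identityʳ _)
  sum-δ {suc n} (suc j) f h =
    trans (cong (_+ sum (f ∘ suc)) (h zero (λ ()))) (sum-δ j (f ∘ suc)
        (λ i p → h (suc i) (p ∘ suc-injective)))

χ : {A : Set} → Dec A → ℕ
χ (yes _) = 1
χ (no _)  = 0

χ≤1 : ∀ {A} (a : Dec A) → χ a ≤ 1
χ≤1 (yes _) = ≤-refl
χ≤1 (no _)  = z≤n

χ-yes : ∀ {A} (a : Dec A) → A → χ a ≡ 1
χ-yes (yes _) _ = refl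
χ-yes (no ¬x) x = ⊥-elim (¬x x)

χ-no : ∀ {A} (a : Dec A) → ¬ A → χ a ≡ 0
χ-no (yes x) ¬x = ⊥-elim (¬x x)
χ-no (no _)  _  = refl

χ-≤ : ∀ {A} (a : Dec A) {m} → (A → 1 ≤ m) → χ a ≤ m
χ-≤ (yes x) h = h x
χ-≤ (no _)  h = z≤n

1≤χ : ∀ {A} (a : Dec A) → A → 1 ≤ χ a
1≤χ a x = ≤-reflexive (sym (χ-yes a x))

χ-mono : ∀ {A B} (a : Dec A) (b : Dec B) → (A → B) → χ a ≤ χ b
χ-mono a b f = χ-≤ a (1≤χ b ∘ f)

χ-cover : ∀ {A B C} (a : Dec A) (b : Dec B) (c : Dec C) → (A → B ⊎ C) → χ a ≤ χ b + χ c
χ-cover a b c f = χ-≤ a λ x → [ (λ y → ≤-trans (1≤χ b y) (m≤m+n _ _)) ,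
    (λ y → ≤-trans (1≤χ c y) (m≤n+m _ _)) ]′ (f x)

χ-disj : ∀ {A B C} (a : Dec A) (b : Dec B) (c : Dec C) → (A → C) → (B → C) → (A → ¬ B) → χ a + χ b ≤ χ c
χ-disj (yes x) b c f g h = ≤-trans (≤-reflexive (cong suc (χ-no b (h x)))) (1≤χ c (f x))
χ-disj (no _)  b c f g h = χ-mono b c g

sum-<⇒∃< : ∀ {n} (f g : Fin n → ℕ) → sum f < sum g → ∃ λ i → f i < g i
sum-<⇒∃< f g h with any? (λ i → f i <? g i)
... | yes p = p
... | no ¬p = ⊥-elim (<⇒≱ h (sum-mono-≤ (λ i → ≮⇒≥ (λ q → ¬p (i , q)))))

abstract
  sum-suc : ∀ {n} (f : Fin (suc n) → ℕ) → sum f ≡ f zero + sum (f ∘ suc)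
  sum-suc f = refl

# : ∀ {n} {P : Fin n → Set} → Decidable P → ℕ
# P? = sum (λ i → χ (P? i))

module _ {n} {P Q : Fin n → Set} (P? : Decidable P) (Q? : Decidable Q) where

  #-mono : (∀ i → P i → Q i) → # P? ≤ # Q?
  #-mono h = sum-mono-≤ (λ i → χ-mono (P? i) (Q? i) (h i))

  #-<⇒∃ : # P? < # Q? → ∃ λ i → Q i × ¬ P i
  #-<⇒∃ h with sum-<⇒∃< _ _ h
  ... | i , p with P? i | Q? i
  ...   | yes _ | yes _ = ⊥-elim (<-irrefl refl p)
  ...   | no ¬p | yes q = i , q , ¬p
  ...   | _     | no _  = ⊥-elim (n≮0 p)

module _ {n} {P Q R : Fin n → Set} (P? : Decidable P) (Q? : Decidable Q) (R? : Decidable R) where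

  #-cover : (∀ i → P i → Q i ⊎ R i) → # P? ≤ # Q? + # R?
  #-cover h = ≤-trans (sum-mono-≤ (λ i → χ-cover (P? i) (Q? i) (R? i) (h i))) (≤-reflexive (sum-+ _ _))

  #-disj : (∀ i → P i → R i) → (∀ i → Q i → R i) → (∀ i → P i → ¬ Q i) → # P? + # Q? ≤ # R?
  #-disj f g h = ≤-trans (≤-reflexive (sym (sum-+ _ _)))
    (sum-mono-≤ (λ i → χ-disj (P? i) (Q? i) (R? i) (f i) (g i) (h i)))

#-singleton : ∀ {n} (j : Fin n) → # (_≟ j) ≡ 1
#-singleton j = trans (sum-δ j _ (λ i p → χ-no (i ≟ j) p)) (χ-yes (j ≟ j) refl)

module _ {n} {P : Fin n → Set} (P? : Decidable P) where

  ∈⇒1≤# : ∀ {i} → P i → 1 ≤ # P?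
  ∈⇒1≤# {i} p = ≤-trans (1≤χ (P? i) p) (term≤sum _ i)

  1≤#⇒∃ : 1 ≤ # P? → ∃ P
  1≤#⇒∃ h = map₂ proj₁ (#-<⇒∃ {P = λ _ → ⊥} (λ _ → no id) P? (≤-trans (s≤s (≤-reflexive (sum-0 n))) h))

  #-none : (∀ i → ¬ P i) → # P? ≡ 0
  #-none h = trans (sum-cong (λ i → χ-no (P? i) (h i))) (sum-0 n)

  unique⊎2≤# : ∀ {i} → P i → (∀ j → P j → j ≡ i) ⊎ 2 ≤ # P?
  unique⊎2≤# {i} p with any? (λ j → P? j ×-dec ¬? (j ≟ i))
  ... | no ¬q = inj₁ (λ j pj → decidable-stable (j ≟ i) (λ j≢i → ¬q (j , pj , j≢i)))
  ... | yes (j , pj , j≢i) = inj₂ (≤-trans (≤-reflexive (sym (cong₂ _+_ (#-singleton i) (#-singleton j))))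
    (#-disj (_≟ i) (_≟ j) P? (λ { _ refl → p }) (λ { _ refl → pj }) (λ { _ refl j≡i → j≢i (sym j≡i) })))

  2≤#⇒∃₂ : 2 ≤ # P? → ∃₂ λ i j → P i × P j × j ≢ i
  2≤#⇒∃₂ h with 1≤#⇒∃ (≤-trans (n≤1+n 1) h)
  ... | i , p with #-<⇒∃ (_≟ i) P? (≤-trans (s≤s (≤-reflexive (#-singleton i))) h)
  ...   | j , q , j≢i = i , j , p , q , j≢i

  #-≤ : # P? ≤ n
  #-≤ = ≤-trans (sum-mono-≤ (λ i → χ≤1 (P? i))) (≤-reflexive (trans (sum-const n 1) (*-identityʳ n)))

#-⊂ : ∀ {n} {P Q : Fin n → Set} (P? : Decidable P) (Q? : Decidable Q) {i} →
      (∀ j → P j → Q j) → Q i → ¬ P i → # P? < # Q?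
#-⊂ P? Q? {i} h q ¬p = ≤-trans (≤-reflexive (trans (+-comm 1 _) (cong (# P? +_) (sym (#-singleton i)))))
  (#-disj P? (_≟ i) Q? h (λ { _ refl → q }) (λ { _ p refl → ¬p p }))

#-fibres : ∀ {m n} {P : Fin n → Set} (P? : Decidable P) (f : Fin n → Fin m) →
           sum (λ c → # (λ i → P? i ×-dec (f i ≟ c))) ≡ # P?
#-fibres P? f = trans (sum-swap _) (sum-cong λ i →
  trans (sum-δ (f i) _ (λ c c≢ → χ-no (P? i ×-dec (f i ≟ c)) (λ { (_ , e) → c≢ (sym e) })))
        (≤-antisym (χ-mono (P? i ×-dec (f i ≟ f i)) (P? i) proj₁)
            (χ-mono (P? i) (P? i ×-dec (f i ≟ f i)) (_, refl))))

-- Elements of least rank and closures under a relation.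

module _ {n} {P : Fin n → Set} (P? : Decidable P) (rank : Fin n → ℕ) where

  argmin : ∃ P → ∃ λ i → P i × (∀ j → rank j < rank i → ¬ P j)
  argmin (i , p) = go i p (<-wellFounded _)
    where
    go : ∀ i → P i → Acc _<_ (rank i) → ∃ λ i → P i × (∀ j → rank j < rank i → ¬ P j)
    go i p (acc rs) with any? (λ j → (rank j <? rank i) ×-dec P? j)
    ... | yes (j , j<i , q) = go j q (rs j<i)
    ... | no ¬q = i , p , λ j j<i q → ¬q (j , j<i , q)

-- The rank makes every witness path descend strictly, hence visit no element twice.
record Closure {n} (S : Fin n → Set) (E : Fin n → Fin n → Set) : Set₁ where
  field
    Mem    : Fin n → Set
    mem?   : Decidable Mem
    rank   : Fin n → ℕ
    base   : ∀ {i} → S i → Mem i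
    step   : ∀ {i j} → E i j → Mem j → Mem i
    origin : ∀ {i} → Mem i → S i ⊎ ∃ λ j → E i j × Mem j × rank j < rank i

  -- Induction along a witness path; with `base` and `step` it makes `Mem` the least set closed
  -- under the rules.
  least : (Z : Fin n → Set) → (∀ {i} → S i → Z i) → (∀ {i j} → E i j → Mem j → Z j → Z i) →
          ∀ {i} → Mem i → Z i
  least Z z₀ z₊ {i} = go i (<-wellFounded _)
    where
    go : ∀ i → Acc _<_ (rank i) → Mem i → Z i
    go i (acc rs) m with origin m
    ... | inj₁ s = z₀ s
    ... | inj₂ (j , e , mj , j<i) = z₊ e mj (go j (rs j<i) mj)

module _ {n} {S : Fin n → Set} (S? : Decidable S)
         {E : Fin n → Fin n → Set} (E? : ∀ i j → Dec (E i j)) where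

  abstract
    -- Elements enter one at a time and the rank records the time of entry, so the witness of a new
    -- element has a smaller rank. Each entry enlarges the set, hence `n` rounds suffice.
    closure : Closure S E
    closure = go n S S? (λ _ → 0) 0 (λ _ _ → z≤n) id inj₁ (m≤n+m _ _)
      where
      go : ∀ fuel (M : Fin n → Set) (M? : Decidable M) (rank : Fin n → ℕ) top →
           (∀ i → M i → rank i ≤ top) → (∀ {i} → S i → M i) →
           (∀ {i} → M i → S i ⊎ ∃ λ j → E i j × M j × rank j < rank i) →
           n ≤ # M? + fuel → Closure S E
      go fuel M M? rank top bound b o enough
        with any? (λ i → ¬? (M? i) ×-dec any? (λ j → E? i j ×-dec M? j))
      ... | no ¬q = record
        { Mem = M ; mem? = M? ; rank = rank ; base = b ; origin = o
        ; step = λ {i} {j} e m → decidable-stable (M? i) (λ ¬m → ¬q (i , ¬m , j , e , m)) }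
      go zero M M? rank top bound b o enough | yes (i , ¬m , _) =
        ⊥-elim (<⇒≱ (≤-trans (#-⊂ M? M⁺? (λ _ → inj₁) (inj₂ refl) ¬m) (#-≤ M⁺?))
            (≤-trans enough (≤-reflexive (+-identityʳ _))))
        where
        M⁺? : Decidable (λ k → M k ⊎ k ≡ i)
        M⁺? k = M? k ⊎-dec (k ≟ i)
      go (suc fuel) M M? rank top bound b o enough | yes (i , ¬m , j , e , m) =
        go fuel (λ k → M k ⊎ k ≡ i) M⁺? rank⁺ (suc top) bound⁺ (inj₁ ∘ b) o⁺
           (≤-trans enough (≤-trans (≤-reflexive (+-suc _ _))
               (+-monoˡ-≤ fuel (#-⊂ M? M⁺? (λ _ → inj₁) (inj₂ refl) ¬m))))
        where
        M⁺? : Decidable (λ k → M k ⊎ k ≡ i)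
        M⁺? k = M? k ⊎-dec (k ≟ i)
        rank⁺ : Fin n → ℕ
        rank⁺ k with k ≟ i
        ... | yes _ = suc top
        ... | no _  = rank k
        rank⁺-old : ∀ {k} → M k → rank⁺ k ≡ rank k
        rank⁺-old {k} mk with k ≟ i
        ... | yes refl = ⊥-elim (¬m mk)
        ... | no _     = refl
        rank⁺-new : rank⁺ i ≡ suc top
        rank⁺-new with i ≟ i
        ... | yes _ = refl
        ... | no ¬p = ⊥-elim (¬p refl)
        bound⁺ : ∀ k → M k ⊎ k ≡ i → rank⁺ k ≤ suc top
        bound⁺ k (inj₁ mk)   = ≤-trans (≤-reflexive (rank⁺-old mk)) (m≤n⇒m≤1+n (bound k mk))
        bound⁺ k (inj₂ refl) = ≤-reflexive rank⁺-new
        o⁺ : ∀ {k} → M k ⊎ k ≡ i → S k ⊎ ∃ λ l → E k l × (M l ⊎ l ≡ i) × rank⁺ l < rank⁺ k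
        o⁺ (inj₂ refl) = inj₂ (j , e , inj₁ m , subst₂ _<_ (sym (rank⁺-old m)) (sym rank⁺-new)
            (s≤s (bound j m)))
        o⁺ (inj₁ mk) with o mk
        ... | inj₁ s = inj₁ s
        ... | inj₂ (l , e′ , ml , l<k) = inj₂ (l , e′ , inj₁ ml , subst₂ _<_ (sym (rank⁺-old ml))
            (sym (rank⁺-old mk)) l<k)

-- Updates of functions and auxiliary inequalities.

_[_↦_] : ∀ {n} {A : Set} → (Fin n → A) → Fin n → A → Fin n → A
(f [ u ↦ c ]) x with x ≟ u
... | yes _ = c
... | no _  = f x

module _ {n} {A : Set} (f : Fin n → A) {u : Fin n} {c : A} where

  ↦-old : ∀ {x} → x ≢ u → (f [ u ↦ c ]) x ≡ f x
  ↦-old {x} x≢u with x ≟ u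
  ... | yes p = ⊥-elim (x≢u p)
  ... | no _  = refl

*χ-≤ : ∀ {A} (a : Dec A) {k m} → (A → k ≤ m) → k * χ a ≤ m
*χ-≤ (yes x) {k} h = ≤-trans (≤-reflexive (*-identityʳ k)) (h x)
*χ-≤ (no _)  {k} h = ≤-trans (≤-reflexive (*-zeroʳ k)) z≤n

≤-*χ : ∀ {A} (a : Dec A) {k m} → m ≤ k → (¬ A → m ≡ 0) → m ≤ k * χ a
≤-*χ (yes _) {k} h _ = ≤-trans h (≤-reflexive (sym (*-identityʳ k)))
≤-*χ (no ¬x) h e = ≤-trans (≤-reflexive (e ¬x)) z≤n

χ-elim : ∀ {A} (a : Dec A) (F : ℕ → Set) → (A → F 1) → (¬ A → F 0) → F (χ a)
χ-elim (yes x) F h _ = h x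
χ-elim (no ¬x) F _ h = h ¬x

-- The common shape of the degree counts below: `x` and `y` are the numbers of neighbours in `A` and
-- in `B`, `t` and `b` count accessible and inaccessible colours, and `s` is what the neighbours in
-- `A` lack.
cancel-balance : ∀ x {y t s b} → x + y < t + b → t ≤ x + s → y < s + b
cancel-balance x {y} {t} {s} {b} h g = +-cancelˡ-< x y (s + b)
  (≤-trans h (≤-trans (+-monoˡ-≤ b g) (≤-reflexive (+-assoc x s b))))

-- This is `(i - k) * (t - b) ≥ 0`, written without subtraction.
rearrangement : ∀ {k i b t} → k ≤ i → b ≤ t → k * t + b * i ≤ k * b + t * i
rearrangement {k} {i} {b} {t} k≤i b≤t with m≤n⇒∃[o]m+o≡n k≤i
... | j , refl = begin
  k * t + b * (k + j)     ≡⟨ lhs k b t j ⟩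
  (k * b + t * k) + b * j ≤⟨ +-monoʳ-≤ (k * b + t * k) (*-monoˡ-≤ j b≤t) ⟩
  (k * b + t * k) + t * j ≡⟨ rhs k b t j ⟩
  k * b + t * (k + j)     ∎
  where
  open ≤-Reasoning
  lhs : ∀ k b t j → k * t + b * (k + j) ≡ (k * b + t * k) + b * j
  lhs = solve-∀
  rhs : ∀ k b t j → (k * b + t * k) + t * j ≡ k * b + t * (k + j)
  rhs = solve-∀

-- The Hajnal-Szemerédi theorem: colourings with bounded classes.

module HajnalSzemerédi
  {N r : ℕ} (k : ℕ)
  (_~_ : Fin N → Fin N → Set) (_~?_ : ∀ x y → Dec (x ~ y))
  (~-sym : ∀ {x y} → x ~ y → y ~ x) (~-irrefl : ∀ {x} → ¬ (x ~ x))
  where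

  record MaximalIndependent (P : Fin N → Set) : Set₁ where
    field
      I       : Fin N → Set
      I?      : Decidable I
      I⊆P     : ∀ {x} → I x → P x
      indep   : ∀ {x y} → I x → I y → ¬ (x ~ y)
      maximal : ∀ {x} → P x → I x ⊎ ∃ λ y → I y × y ~ x

  abstract
    maximalIndependent : {P : Fin N → Set} → Decidable P → MaximalIndependent P
    maximalIndependent {P} P? =
      go N (λ _ → ⊥) (λ _ → no id) ⊥-elim (λ ()) (m≤n+m _ _)
      where
      go : ∀ fuel (I : Fin N → Set) (I? : Decidable I) → (∀ {x} → I x → P x) →
           (∀ {x y} → I x → I y → ¬ (x ~ y)) → N ≤ # I? + fuel → MaximalIndependent P
      go fuel I I? I⊆P indep enough
        with any? (λ x → P? x ×-dec (¬? (I? x) ×-dec ¬? (any? (λ y → I? y ×-dec (y ~? x)))))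
      ... | no ¬q = record { I = I ; I? = I? ; I⊆P = I⊆P ; indep = indep ; maximal = maximal }
        where
        maximal : ∀ {x} → P x → I x ⊎ ∃ λ y → I y × y ~ x
        maximal {x} p with I? x | any? (λ y → I? y ×-dec (y ~? x))
        ... | yes i | _     = inj₁ i
        ... | no _  | yes a = inj₂ a
        ... | no ¬i | no ¬a = ⊥-elim (¬q (x , p , ¬i , ¬a))
      ... | yes (x , p , ¬i , ¬a) = grow fuel enough
        where
        I⁺? : Decidable (λ y → I y ⊎ y ≡ x)
        I⁺? y = I? y ⊎-dec (y ≟ x)
        larger : # I? < # I⁺?
        larger = #-⊂ I? I⁺? (λ _ → inj₁) (inj₂ refl) ¬i
        indep⁺ : ∀ {y z} → I y ⊎ y ≡ x → I z ⊎ z ≡ x → ¬ (y ~ z)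
        indep⁺ (inj₁ i)    (inj₁ j)    a = indep i j a
        indep⁺ (inj₁ i)    (inj₂ refl) a = ¬a (_ , i , a)
        indep⁺ (inj₂ refl) (inj₁ j)    a = ¬a (_ , j , ~-sym a)
        indep⁺ (inj₂ refl) (inj₂ refl) a = ~-irrefl a
        grow : ∀ fuel → N ≤ # I? + fuel → MaximalIndependent P
        grow zero       enough = ⊥-elim (<⇒≱ (≤-trans larger (#-≤ I⁺?))
            (≤-trans enough (≤-reflexive (+-identityʳ _))))
        grow (suc fuel) enough = go fuel _ I⁺? [ I⊆P , (λ { refl → p }) ]′ indep⁺
          (≤-trans enough (≤-trans (≤-reflexive (+-suc _ _)) (+-monoˡ-≤ fuel larger)))

  class? : {P : Fin N → Set} → Decidable P → (f : Fin N → Fin r) → ∀ c → Decidable (λ x → P x × f x ≡ c)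
  class? P? f c x = P? x ×-dec (f x ≟ c)

  -- Vertex set `P` and palette `Q` both vary, because the exchange step recolours a part of the
  -- graph with the inaccessible colours alone. The bound `k` takes the place of equitability.
  record Proper {P : Fin N → Set} (P? : Decidable P) (Q : Fin r → Set) (f : Fin N → Fin r) : Set where
    field
      inQ     : ∀ {x} → P x → Q (f x)
      proper  : ∀ {x y} → P x → P y → x ~ y → f x ≢ f y
      bounded : ∀ c → # (class? P? f c) ≤ k

  Free : (P : Fin N → Set) → (Fin N → Fin r) → Fin N → Fin r → Set
  Free P f u c = ¬ ∃ λ x → (P x × f x ≡ c) × u ~ x

  neighbour? : {P : Fin N → Set} → Decidable P → ∀ f u c → Dec (∃ λ x → (P x × f x ≡ c) × u ~ x)
  neighbour? P? f u c = any? (λ x → class? P? f c x ×-dec (u ~? x))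

  free? : {P : Fin N → Set} → Decidable P → ∀ f u c → Dec (Free P f u c)
  free? P? f u c = ¬? (neighbour? P? f u c)

  module _ {Q : Fin r → Set} {S P : Fin N → Set} (S? : Decidable S) (P? : Decidable P)
           {g : Fin N → Fin r} (col : Proper S? Q g) {u c} (Qc : Q c) (free : Free S g u c)
           (P⊆ : ∀ {x} → P x → S x ⊎ x ≡ u) where
    open Proper col

    private
      g⁺ : Fin N → Fin r
      g⁺ = g [ u ↦ c ]

      class⁺ : ∀ {d x} → P x → g⁺ x ≡ d → (x ≡ u × c ≡ d) ⊎ (x ≢ u × S x × g x ≡ d)
      class⁺ {x = x} p e with x ≟ u
      ... | yes x≡u = inj₁ (x≡u , e)
      ... | no x≢u  = inj₂ (x≢u , [ id , ⊥-elim ∘ x≢u ]′ (P⊆ p) , e)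

    -- `P` may omit vertices of `S`, so a vertex can enter the class `c` while another one is taken
    -- out; only the class `c` can grow.
    extend : # (class? P? g⁺ c) ≤ k → Proper P? Q g⁺
    extend bound = record { inQ = inQ⁺ ; proper = proper⁺ ; bounded = bounded⁺ }
      where
      inQ⁺ : ∀ {x} → P x → Q (g⁺ x)
      inQ⁺ p with class⁺ p refl
      ... | inj₁ (_ , e)     = subst Q e Qc
      ... | inj₂ (_ , s , e) = subst Q e (inQ s)
      proper⁺ : ∀ {x y} → P x → P y → x ~ y → g⁺ x ≢ g⁺ y
      proper⁺ p q a e with class⁺ p e | class⁺ q refl
      ... | inj₁ (refl , _)  | inj₁ (refl , _)   = ~-irrefl a
      ... | inj₁ (refl , e₁) | inj₂ (_ , s , e₂) = free (_ , (s , trans e₂ (sym e₁)) , a)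
      ... | inj₂ (_ , s , e₁) | inj₁ (refl , e₂) = free (_ , (s , trans e₁ (sym e₂)) , ~-sym a)
      ... | inj₂ (_ , s , e₁) | inj₂ (_ , t , e₂) = proper s t a (trans e₁ (sym e₂))
      bounded⁺ : ∀ d → # (class? P? g⁺ d) ≤ k
      bounded⁺ d with c ≟ d
      ... | yes refl = bound
      ... | no c≢d = ≤-trans (#-mono (class? P? g⁺ d) (class? S? g d) sub) (bounded d)
        where
        sub : ∀ x → P x × g⁺ x ≡ d → S x × g x ≡ d
        sub x (p , e) with class⁺ p e
        ... | inj₁ (_ , e′) = ⊥-elim (c≢d e′)
        ... | inj₂ (_ , s)  = s

    extend-below : # (class? S? g c) < k → Proper P? Q g⁺
    extend-below h = extend (≤-trans (#-cover (class? P? g⁺ c) (class? S? g c) (_≟ u) sub)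
      (≤-trans (≤-reflexive (trans (cong (_ +_) (#-singleton u)) (+-comm _ 1))) h))
      where
      sub : ∀ x → P x × g⁺ x ≡ c → (S x × g x ≡ c) ⊎ x ≡ u
      sub x (p , e) with class⁺ p e
      ... | inj₁ (x≡u , _) = inj₂ x≡u
      ... | inj₂ (_ , s)   = inj₁ s

    extend-swap : ∀ {z} → S z → g z ≡ c → (∀ {x} → P x → x ≢ z) → Proper P? Q g⁺
    extend-swap {z} sz gz P∌z = extend (≤-trans (+-cancelʳ-≤ 1 _ _ (≤-trans
        (≤-reflexive (trans (cong (_ +_) (sym (#-singleton z))) (sym (sum-+ _ _))))
        (≤-trans (sum-mono-≤ pointwise) (≤-reflexive (trans (sum-+ _ _) (cong (_ +_) (#-singleton u)))))))
        (bounded c))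
      where
      pointwise : ∀ x → χ (class? P? g⁺ c x) + χ (x ≟ z) ≤ χ (class? S? g c x) + χ (x ≟ u)
      pointwise x with x ≟ z
      ... | yes refl = ≤-trans (≤-reflexive (cong (_+ 1)
          (χ-no (class? P? g⁺ c x) (λ (p , _) → P∌z p refl))))
                         (≤-trans (1≤χ (class? S? g c x) (sz , gz)) (m≤m+n _ _))
      ... | no _ = ≤-trans (≤-reflexive (+-identityʳ _))
          (χ-cover (class? P? g⁺ c x) (class? S? g c x) (x ≟ u) sub)
        where
        sub : P x × g⁺ x ≡ c → (S x × g x ≡ c) ⊎ x ≡ u
        sub (p , e) with class⁺ p e
        ... | inj₁ (x≡u , _) = inj₂ x≡u
        ... | inj₂ (_ , s)   = inj₁ s

  -- Accessible classes and shifting along a path to a sink.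

  module Accessibility {R : Fin N → Set} (R? : Decidable R) {Q : Fin r → Set} (Q? : Decidable Q)
                       (f : Fin N → Fin r) where

    Sink : Fin r → Set
    Sink c = Q c × # (class? R? f c) < k

    -- The digraph of Kierstead and Kostochka on the colour classes: an edge means that some vertex
    -- of `c` can be recoloured `d`.
    Move : Fin r → Fin r → Set
    Move c d = ∃ λ x → (R x × f x ≡ c) × Free R f x d

    sink? : Decidable Sink
    sink? c = Q? c ×-dec (# (class? R? f c) <? k)

    move? : ∀ c d → Dec (Move c d)
    move? c d = any? (λ x → class? R? f c x ×-dec free? R? f x d)

    abstract
      accessible : Closure Sink Move
      accessible = closure sink? move?

      -- The classes with a path to a sink that never meets `U`: every class on such a path is
      -- either the sink or the source of an edge, and both are required to differ from `U`.
      avoiding : (U : Fin r) → Closure (λ c → Sink c × c ≢ U) (λ c d → Move c d × c ≢ U)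
      avoiding U = closure (λ c → sink? c ×-dec ¬? (c ≟ U)) (λ c d → move? c d ×-dec ¬? (c ≟ U))

    module T = Closure accessible

    module Avoid U = Closure (avoiding U)

    -- `u` enters the class `c` and, unless `c` is a sink, a movable vertex leaves it for the next
    -- class on the path. Ranks fall strictly, so the classes still to be entered are as they were
    -- under `f`; the two inclusions between `g` and `f` record this and keep the moves found for
    -- `f` legal.
    shift : (∀ {x} → R x → Q (f x)) → ∀ {S P} (S? : Decidable S) (P? : Decidable P) {g} →
        Proper S? Q g → ∀ {u c} →
            Acc _<_ (T.rank c) → T.Mem c → ¬ S u →
            (∀ {d x} → T.rank d ≤ T.rank c → S x × g x ≡ d → R x × f x ≡ d) →
            (∀ {d x} → T.rank d ≤ T.rank c → R x × f x ≡ d → S x × g x ≡ d) →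
            Free S g u c → (∀ {x} → P x → S x ⊎ x ≡ u) → ∃ (Proper P? Q)
    shift inQ {S} {P} S? P? {g} col {u} {c} (acc rs) Tc ¬Su to from free P⊆ with T.origin Tc
    ... | inj₁ (Qc , h) = _ , extend-below S? P? col Qc free P⊆
          (≤-trans (s≤s (#-mono (class? S? g c) (class? R? f c) (λ _ → to ≤-refl))) h)
    ... | inj₂ (d , (x , Rx@(_ , fx≡c) , free′) , Td , d<c) =
      shift inQ S⁻? P? (extend-swap S? S⁻? col (subst Q fx≡c (inQ (proj₁ Rx))) free proj₁ (proj₁ Sx)
          (proj₂ Sx) proj₂)
        (rs d<c) Td (λ s → proj₂ s refl) to′ from′
        (λ (y , c′ , a) → free′ (y , to′ ≤-refl c′ , a)) P⊆′
      where
      Sx : S x × g x ≡ c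
      Sx = from ≤-refl Rx
      S⁻? : Decidable (λ y → (S y ⊎ y ≡ u) × y ≢ x)
      S⁻? y = (S? y ⊎-dec (y ≟ u)) ×-dec ¬? (y ≟ x)
      e≢c : ∀ {e} → T.rank e ≤ T.rank d → e ≢ c
      e≢c e≤d refl = <⇒≱ d<c e≤d
      to′ : ∀ {e y} → T.rank e ≤ T.rank d → ((S y ⊎ y ≡ u) × y ≢ x) × (g [ u ↦ c ]) y ≡ e → R y × f y ≡ e
      to′ {y = y} e≤d ((s , _) , q) with y ≟ u
      ... | yes _  = ⊥-elim (e≢c e≤d (sym q))
      ... | no y≢u = to (≤-trans e≤d (<⇒≤ d<c)) ([ id , ⊥-elim ∘ y≢u ]′ s , q)
      from′ : ∀ {e y} → T.rank e ≤ T.rank d → R y × f y ≡ e → ((S y ⊎ y ≡ u) × y ≢ x) × (g [ u ↦ c ]) y ≡ e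
      from′ {y = y} e≤d ry with from (≤-trans e≤d (<⇒≤ d<c)) ry
      ... | s , q = (inj₁ s , λ { refl → e≢c e≤d (trans (sym q) (proj₂ Sx)) }) ,
                    trans (↦-old g (λ { refl → ¬Su s })) q
      P⊆′ : ∀ {y} → P y → ((S y ⊎ y ≡ u) × y ≢ x) ⊎ y ≡ x
      P⊆′ {y} p with y ≟ x
      ... | yes e = inj₂ e
      ... | no ne = inj₁ (P⊆ p , ne)

  -- One uncoloured vertex `v`: accessible and inaccessible parts.

  module Step
    {P : Fin N → Set} (P? : Decidable P) {Q : Fin r → Set} (Q? : Decidable Q)
    (size : # P? ≤ k * # Q?)
    (deg : ∀ {x} → P x → # (λ y → (x ~? y) ×-dec P? y) < # Q?)
    where

    Rest : Fin N → Fin N → Set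
    Rest v x = P x × x ≢ v

    rest? : ∀ v → Decidable (Rest v)
    rest? v x = P? x ×-dec ¬? (x ≟ v)

    module State (v : Fin N) (Pv : P v) (f : Fin N → Fin r) (col : Proper (rest? v) Q f) where

      open Proper col
      open Accessibility (rest? v) Q? f public

      private
        R : Fin N → Set
        R = Rest v
        R? : Decidable R
        R? = rest? v

      T? : Decidable T.Mem
      T? = T.mem?

      T⊆Q : ∀ {c} → T.Mem c → Q c
      T⊆Q Tc with T.origin Tc
      ... | inj₁ (Qc , _) = Qc
      ... | inj₂ (_ , (_ , (Rx , refl) , _) , _) = inQ Rx

      finish : ∀ {c} → T.Mem c → Free R f v c → ∃ (Proper P? Q)
      finish Tc free = shift inQ R? P? col (<-wellFounded _) Tc (λ s → proj₂ s refl)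
                         (λ _ → id) (λ _ → id) free split
        where
        split : ∀ {x} → P x → R x ⊎ x ≡ v
        split {x} p with x ≟ v
        ... | yes e = inj₂ e
        ... | no ne = inj₁ (p , ne)

      -- Without `v` the total falls below `k` times the number of colours, so not all classes are
      -- full.
      T-nonempty : ∃ T.Mem
      T-nonempty with sum-<⇒∃< (λ c → # (class? R? f c)) (λ c → k * χ (Q? c)) (begin-strict
          sum (λ c → # (class? R? f c)) ≡⟨ #-fibres R? f ⟩
          # R?                          <⟨ #-⊂ R? P? (λ _ → proj₁) Pv (λ s → proj₂ s refl) ⟩
          # P?                          ≤⟨ size ⟩
          k * # Q?                      ≡⟨ sum-*ˡ k _ ⟨
          sum (λ c → k * χ (Q? c))      ∎)
        where open ≤-Reasoning
      ... | c , h with Q? c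
      ...   | yes Qc = c , T.base (Qc , ≤-trans h (≤-reflexive (*-identityʳ k)))
      ...   | no _   = ⊥-elim (n≮0 (≤-trans h (≤-reflexive (*-zeroʳ k))))

      Inaccessible : Fin r → Set
      Inaccessible c = Q c × ¬ T.Mem c

      inaccessible? : Decidable Inaccessible
      inaccessible? c = Q? c ×-dec ¬? (T? c)

      b : ℕ
      b = # inaccessible?

      #Q : # Q? ≡ # T? + b
      #Q = ≤-antisym
        (#-cover Q? T? inaccessible? λ c Qc → [ inj₁ , (λ ¬t → inj₂ (Qc , ¬t)) ]′ (toSum (T? c)))
        (#-disj T? inaccessible? Q? (λ _ → T⊆Q) (λ _ → proj₁) (λ _ t i → proj₂ i t))
  
      A : Fin N → Set
      A x = R x × T.Mem (f x)

      A? : Decidable A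
      A? x = R? x ×-dec T? (f x)

      -- The uncoloured `v` is included: when it cannot enter any accessible class, it behaves like
      -- a vertex of an inaccessible class.
      B : Fin N → Set
      B x = P x × (x ≡ v ⊎ ¬ T.Mem (f x))

      B? : Decidable B
      B? x = P? x ×-dec ((x ≟ v) ⊎-dec ¬? (T? (f x)))

      B∌A : ∀ {x} → B x → ¬ A x
      B∌A (_ , inj₁ e)  ((_ , ne) , _) = ne e
      B∌A (_ , inj₂ ¬t) (_ , t)        = ¬t t

      A⊎B : ∀ {x} → P x → A x ⊎ B x
      A⊎B {x} p with x ≟ v | T? (f x)
      ... | yes e | _     = inj₂ (p , inj₁ e)
      ... | no ne | yes t = inj₁ ((p , ne) , t)
      ... | no _  | no ¬t = inj₂ (p , inj₂ ¬t)

      private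
        B⁻? : Decidable (λ x → R x × ¬ T.Mem (f x))
        B⁻? x = R? x ×-dec ¬? (T? (f x))

        class⁻? : ∀ c → Decidable (λ x → (R x × ¬ T.Mem (f x)) × f x ≡ c)
        class⁻? = class? B⁻? f

      -- A class below `k` is a sink, so the inaccessible classes are full; `v` makes the inequality
      -- strict.
      B-lower : k * b < # B?
      B-lower = begin-strict
        k * b                              ≡⟨ sum-*ˡ k _ ⟨
        sum (λ c → k * χ (inaccessible? c)) ≤⟨ sum-mono-≤ (λ c → *χ-≤ (inaccessible? c) (full c)) ⟩
        sum (λ c → # (class⁻? c))          ≡⟨ #-fibres B⁻? f ⟩
        # B⁻?                              <⟨ #-⊂ B⁻? B? (λ { x ((p , _) , ¬t) → p , inj₂ ¬t })
            (Pv , inj₁ refl) (λ s → proj₂ (proj₁ s) refl) ⟩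
        # B?                               ∎
        where
        open ≤-Reasoning
        full : ∀ c → Inaccessible c → k ≤ # (class⁻? c)
        full c (Qc , ¬t) = ≤-trans (≮⇒≥ (λ h → ¬t (T.base (Qc , h))))
          (#-mono (class? R? f c) (class⁻? c) (λ { x (rx , refl) → (rx , ¬t) , refl }))

      -- What the recursion needs: after the removal of one vertex, `B` fits into `b` classes of
      -- size `k`.
      B-upper : # B? ≤ suc (k * b)
      B-upper = begin
        # B?                               ≤⟨ #-cover B? (_≟ v) B⁻?
            (λ { x (p , inj₁ e) → inj₁ e ; x (p , inj₂ ¬t) → split p ¬t }) ⟩
        # (_≟ v) + # B⁻?                   ≡⟨ cong (_+ # B⁻?) (#-singleton v) ⟩
        suc (# B⁻?)                        ≡⟨ cong suc (#-fibres B⁻? f) ⟨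
        suc (sum (λ c → # (class⁻? c)))     ≤⟨ s≤s (sum-mono-≤ (λ c → ≤-*χ (inaccessible? c)
                                                (≤-trans (#-mono (class⁻? c) (class? R? f c)
                                                    (λ { x ((rx , _) , e) → rx , e })) (bounded c))
                                                (λ ¬i → #-none (class⁻? c)
                                                    (λ { x ((rx , ¬t) , refl) → ¬i (inQ rx , ¬t) })))) ⟩
        suc (sum (λ c → k * χ (inaccessible? c))) ≡⟨ cong suc (sum-*ˡ k _) ⟩
        suc (k * b)                        ∎
        where
        open ≤-Reasoning
        split : ∀ {x} → P x → ¬ T.Mem (f x) → x ≡ v ⊎ (R x × ¬ T.Mem (f x))
        split {x} p ¬t with x ≟ v
        ... | yes e = inj₁ e
        ... | no ne = inj₂ ((p , ne) , ¬t)

      dA dB : Fin N → ℕ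
      dA y = # (λ x → (y ~? x) ×-dec A? x)
      dB y = # (λ x → (y ~? x) ×-dec B? x)

      degree-split : ∀ {y} → P y → dA y + dB y < # T? + b
      degree-split {y} p = ≤-trans (s≤s (#-disj (λ x → (y ~? x) ×-dec A? x)
          (λ x → (y ~? x) ×-dec B? x) (λ x → (y ~? x) ×-dec P? x)
          (λ { x (a , ((px , _) , _)) → a , px }) (λ { x (a , (px , _)) → a , px })
              (λ { x (_ , a) (_ , b) → B∌A b a })))
        (≤-trans (deg p) (≤-reflexive #Q))

      neighbours? : ∀ y c → Decidable (λ x → (y ~ x × A x) × f x ≡ c)
      neighbours? y c = class? (λ x → (y ~? x) ×-dec A? x) f c

      neighbours-sum : ∀ y → sum (λ c → # (neighbours? y c)) ≡ dA y
      neighbours-sum y = #-fibres (λ x → (y ~? x) ×-dec A? x) f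

      -- `z` alone keeps `y` out of the class `f z`: once `z` leaves, `y` can take its place.
      Solo : Fin N → Fin N → Set
      Solo y z = y ~ z × (∀ x → (y ~ x × A x) × f x ≡ f z → x ≡ z)

      solo? : ∀ y z → Dec (Solo y z)
      solo? y z = (y ~? z) ×-dec all? (λ x → neighbours? y (f z) x →-dec (x ≟ z))

      not-free : ∀ {y c} → T.Mem c → ¬ Free R f y c → ∃ λ x → (y ~ x × A x) × f x ≡ c
      not-free {y} {c} Tc nf with decidable-stable (neighbour? R? f y c) nf
      ... | x , (rx , refl) , a = x , (a , rx , Tc) , refl

      module Blocked (blocked : ∀ {c} → T.Mem c → ¬ Free R f v c) where

        -- Otherwise `y` could move to `c` and its class would be accessible; for `v` this is
        -- `blocked`.
        B-neighbour : ∀ {y c} → B y → T.Mem c → ∃ λ x → (y ~ x × A x) × f x ≡ c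
        B-neighbour {y} (p , inj₁ refl) Tc = not-free Tc (blocked Tc)
        B-neighbour {y} {c} (p , inj₂ ¬t) Tc with y ≟ v
        ... | yes refl = not-free Tc (blocked Tc)
        ... | no y≢v   = not-free Tc (λ free → ¬t (T.step (y , ((p , y≢v) , refl) , free) Tc))

        -- The accessible classes use up at least `# T?` neighbours of `y`. The rest meets the
        -- degree condition for colouring parts of `B` with the inaccessible colours.
        dB<b : ∀ {y} → B y → dB y < b
        dB<b {y} By = +-cancelˡ-< (# T?) (dB y) b (≤-<-trans (+-monoˡ-≤ (dB y) (begin
            # T?                            ≤⟨ sum-mono-≤
                (λ c → χ-≤ (T? c) (λ Tc → ∈⇒1≤# (neighbours? y c) (proj₂ (B-neighbour By Tc)))) ⟩
            sum (λ c → # (neighbours? y c)) ≡⟨ neighbours-sum y ⟩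
            dA y                            ∎))
          (degree-split (proj₁ By)))
          where open ≤-Reasoning

      -- Domination among accessible classes and the choice of terminal classes.

      Cut : Fin r → Fin r → Set
      Cut U c = T.Mem c × c ≢ U × ¬ Avoid.Mem U c

      cut? : ∀ U → Decidable (Cut U)
      cut? U c = T? c ×-dec (¬? (c ≟ U) ×-dec ¬? (Avoid.mem? U c))

      avoid⊆T : ∀ {U c} → Avoid.Mem U c → T.Mem c
      avoid⊆T {U} = Avoid.least U T.Mem (T.base ∘ proj₁) (λ e _ → T.step (proj₁ e))

      avoid≢ : ∀ {U c} → Avoid.Mem U c → c ≢ U
      avoid≢ {U} a with Avoid.origin U a
      ... | inj₁ (_ , ne) = ne
      ... | inj₂ (_ , (_ , ne) , _) = ne

      -- A path that misses `U` cannot meet `W`, since from there on `W` would have a path missing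
      -- `U`.
      avoid-avoid : ∀ {U W c} → ¬ Avoid.Mem U W → Avoid.Mem U c → Avoid.Mem W c
      avoid-avoid {U} {W} ¬W = Avoid.least U (Avoid.Mem W)
          (λ s → Avoid.base W (proj₁ s , λ { refl → ¬W (Avoid.base U s) }))
          (λ e m a → Avoid.step W (proj₁ e , λ { refl → ¬W (Avoid.step U e m) }) a)

      -- On a path from `U` to a sink, consider what follows the last visit to `U`.
      exit : ∀ {U} → T.Mem U → Sink U ⊎ ∃ λ c → Move U c × Avoid.Mem U c
      exit {U} TU with T.least (λ c → Avoid.Mem U c ⊎ (Sink U ⊎ ∃ λ c → Move U c × Avoid.Mem U c)) z₀ z₊ TU
        where
        z₀ : ∀ {c} → Sink c → Avoid.Mem U c ⊎ (Sink U ⊎ ∃ λ c → Move U c × Avoid.Mem U c)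
        z₀ {c} s with c ≟ U
        ... | yes refl = inj₂ (inj₁ s)
        ... | no ne    = inj₁ (Avoid.base U (s , ne))
        z₊ : ∀ {c d} → Move c d → T.Mem d → Avoid.Mem U d ⊎ (Sink U ⊎ ∃ λ c → Move U c × Avoid.Mem U c) →
             Avoid.Mem U c ⊎ (Sink U ⊎ ∃ λ c → Move U c × Avoid.Mem U c)
        z₊ e _ (inj₂ g) = inj₂ g
        z₊ {c} {d} e _ (inj₁ a) with c ≟ U
        ... | yes refl = inj₂ (inj₂ (d , e , a))
        ... | no ne    = inj₁ (Avoid.step U (e , ne) a)
      ... | inj₁ a = ⊥-elim (avoid≢ a refl)
      ... | inj₂ g = g

      -- The delicate point is `c ≢ U`: `U` has a way to a sink that does not return to `U`, and
      -- this way misses `W` because `W` depends on `U`.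
      cut-trans : ∀ {U W c} → T.Mem U → Cut U W → Cut W c → Cut U c
      cut-trans {U} {W} {c} TU (TW , W≢U , ¬W) (Tc , c≢W , ¬c) = Tc , c≢U , λ a → ¬c (avoid-avoid ¬W a)
        where
        c≢U : c ≢ U
        c≢U refl with exit TU
        ... | inj₁ s = ¬c (Avoid.base W (s , c≢W))
        ... | inj₂ (d , e , a) = ¬c (Avoid.step W (e , c≢W) (avoid-avoid ¬W a))

      -- A set of classes each of which can be removed without disconnecting the others from the
      -- sinks, and whose vertices move outside the set to at most one accessible class, the gate.
      record Terminals : Set₁ where
        field
          Mem      : Fin r → Set
          mem?     : Decidable Mem
          some     : ∃ Mem
          ⊆T       : ∀ {c} → Mem c → T.Mem c
          terminal : ∀ {W c} → Mem W → T.Mem c → c ≢ W → Avoid.Mem W c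
          gate     : Fin r
          gated    : ∀ {W c} → Mem W → T.Mem c → ¬ Mem c → c ≢ gate → ¬ Move W c

      abstract
        -- While some class `W` of the present set cuts off others, pass to the classes cut off by
        -- `W`, with `W` as the gate. A move from one of them to any other accessible class that is
        -- not cut off would open a way around `W`. The set shrinks each time, since it loses `W`.
        terminals : Terminals
        -- At the start no accessible class lies outside the set, so any class can serve as the
        -- gate.
        terminals = go (T.Mem) T? T-nonempty id (λ _ → proj₁) (proj₁ T-nonempty)
            (λ _ Tc ¬Tc _ → ⊥-elim (¬Tc Tc)) (<-wellFounded _)
          where
          go : ∀ (M : Fin r → Set) (M? : Decidable M) → ∃ M → (∀ {c} → M c → T.Mem c) →
               (∀ {W c} → M W → Cut W c → M c) →
               ∀ g → (∀ {W c} → M W → T.Mem c → ¬ M c → c ≢ g → ¬ Move W c) → Acc _<_ (# M?) → Terminals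
          go M M? some ⊆T hereditary g gated (acc rs)
            with any? (λ W → M? W ×-dec any? (cut? W))
          ... | no ¬q = record { Mem = M ; mem? = M? ; some = some ; ⊆T = ⊆T ; gate = g ; gated = gated
                               ; terminal = λ {W} {c} m Tc c≢W → decidable-stable (Avoid.mem? W c)
                                   (λ ¬a → ¬q (W , m , c , Tc , c≢W , ¬a)) }
          ... | yes (W , m , c , cut) = go (Cut W) (cut? W) (c , cut) proj₁
              (λ c₁ c₂ → cut-trans (⊆T m) c₁ c₂) W gated′
                  (rs (#-⊂ (cut? W) M? (λ _ → hereditary m) m (λ s → proj₁ (proj₂ s) refl)))
            where
            gated′ : ∀ {X d} → Cut W X → T.Mem d → ¬ Cut W d → d ≢ W → ¬ Move X d
            gated′ {X} {d} (_ , X≢W , ¬X) Td ¬cut d≢W e =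
              ¬X (Avoid.step W (e , X≢W) (decidable-stable (Avoid.mem? W d) (λ ¬a → ¬cut (Td , d≢W , ¬a))))

      -- Counting solo neighbours in terminal classes.

      module SoloCount
        (blocked : ∀ {c} → T.Mem c → ¬ Free R f v c)
        (ts : Terminals)
        (unmovable : ∀ {y z c} → B y → A z → Terminals.Mem ts (f z) → Solo y z →
                     T.Mem c → c ≢ f z → ¬ Free R f z c)
        where

        module Ts = Terminals ts
        open Blocked blocked

        t : ℕ
        t = # Ts.mem?

        -- Being unmovable, `z` has a neighbour in every accessible class but its own, which leaves
        -- room for at most `b` neighbours in `B`.
        solo-dB : ∀ {y z} → B y → A z → Ts.Mem (f z) → Solo y z → dB z ≤ b
        solo-dB {y} {z} By Az tz s = s≤s⁻¹ (cancel-balance (dA z) (degree-split (proj₁ (proj₁ Az))) (begin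
            # T?                                                    ≤⟨ sum-mono-≤ bound ⟩
            sum (λ c → # (neighbours? z c) + χ (c ≟ f z))           ≡⟨ sum-+ _ _ ⟩
            sum (λ c → # (neighbours? z c)) + # (_≟ f z)
                ≡⟨ cong₂ _+_ (neighbours-sum z) (#-singleton (f z)) ⟩
            dA z + 1                                                ∎))
          where
          open ≤-Reasoning
          bound : ∀ c → χ (T? c) ≤ # (neighbours? z c) + χ (c ≟ f z)
          bound c = χ-≤ (T? c) λ Tc → [ (λ e → ≤-trans (1≤χ (c ≟ f z) e) (m≤n+m _ _))
                                      , (λ ne → ≤-trans (∈⇒1≤# (neighbours? z c)
                                          (proj₂ (not-free Tc (unmovable By Az tz s Tc ne)))) (m≤m+n _ _))
                                      ]′ (toSum (c ≟ f z))

        -- `z` has a neighbour in every accessible class that is neither terminal nor the gate.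
        terminal-dB : ∀ {z} → A z → Ts.Mem (f z) → dB z ≤ t + b
        terminal-dB {z} Az tz = s≤s⁻¹ (cancel-balance (dA z) (degree-split (proj₁ (proj₁ Az))) (begin
            # T?                                                              ≤⟨ sum-mono-≤ bound ⟩
            sum (λ c → # (neighbours? z c) + (χ (c ≟ Ts.gate) + χ (Ts.mem? c)))
                ≡⟨ trans (sum-+ _ _) (cong (sum (λ c → # (neighbours? z c)) +_) (sum-+ _ _)) ⟩
            sum (λ c → # (neighbours? z c)) + (# (_≟ Ts.gate) + t)
                ≡⟨ cong₂ _+_ (neighbours-sum z) (cong (_+ t) (#-singleton Ts.gate)) ⟩
            dA z + suc t                                                      ∎))
          where
          open ≤-Reasoning
          bound : ∀ c → χ (T? c) ≤ # (neighbours? z c) + (χ (c ≟ Ts.gate) + χ (Ts.mem? c))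
          bound c = χ-≤ (T? c) λ Tc → go Tc (c ≟ Ts.gate) (Ts.mem? c)
            where
            go : T.Mem c → (e : Dec (c ≡ Ts.gate)) (m : Dec (Ts.Mem c)) →
                1 ≤ # (neighbours? z c) + (χ e + χ m)
            go Tc (yes _) m      = ≤-trans (s≤s z≤n) (m≤n+m _ (# (neighbours? z c)))
            go Tc (no _) (yes _) = m≤n+m 1 _
            go Tc (no ne) (no ¬m) = ≤-trans (∈⇒1≤# (neighbours? z c) (proj₂ (not-free Tc (λ free →
              Ts.gated tz Tc ¬m ne (z , (proj₁ Az , refl) , free))))) (m≤m+n _ _)

        -- Count the edges between `B` and one terminal class `W`, solo edges twice. Every vertex of
        -- `B` contributes at least 2. If `t ≤ b`, every `z` in `W` receives at most `2b`: twice `b`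
        -- by `solo-dB` if it has a solo edge, and at most `t + b` otherwise. Then `B` has at most
        -- `k * b` vertices, against `B-lower`.
        b<t : b < t
        b<t = ≰⇒> λ t≤b → <⇒≱ B-lower (*-cancelˡ-≤ 2 (begin
            2 * # B?                                              ≡⟨ sum-*ˡ 2 _ ⟨
            sum (λ y → 2 * χ (B? y))
                ≤⟨ sum-mono-≤ (λ y → *χ-≤ (B? y) (two y)) ⟩
            sum (λ y → # (edge? y) + # (soloEdge? y))             ≡⟨ sum-cong (λ y → sum-+ _ _) ⟨
            sum (λ y → sum (λ z → χ (edge? y z) + χ (soloEdge? y z))) ≡⟨ sum-swap _ ⟩
            sum (λ z → sum (λ y → χ (edge? y z) + χ (soloEdge? y z))) ≡⟨ sum-cong (λ z → sum-+ _ _) ⟩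
            sum (λ z → # (λ y → edge? y z) + # (λ y → soloEdge? y z))
                ≤⟨ sum-mono-≤ (λ z → ≤-*χ (A? z ×-dec (f z ≟ W)) (atMost t≤b z) (outside z)) ⟩
            sum (λ z → (b + b) * χ (A? z ×-dec (f z ≟ W)))        ≡⟨ sum-*ˡ (b + b) _ ⟩
            (b + b) * # (class? A? f W)
                ≤⟨ *-monoʳ-≤ (b + b) (≤-trans (#-mono (class? A? f W) (class? R? f W)
                    (λ { x ((rx , _) , e) → rx , e })) (bounded W)) ⟩
            (b + b) * k                                           ≡⟨ regroup b k ⟩
            2 * (k * b)                                           ∎))
          where
          open ≤-Reasoning
          regroup : ∀ b k → (b + b) * k ≡ 2 * (k * b)
          regroup = solve-∀
          W = proj₁ Ts.some
          tW = proj₂ Ts.some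
          edge? : ∀ y z → Dec (B y × (y ~ z × A z) × f z ≡ W)
          edge? y z = B? y ×-dec neighbours? y W z
          soloEdge? : ∀ y z → Dec ((B y × (y ~ z × A z) × f z ≡ W) × Solo y z)
          soloEdge? y z = edge? y z ×-dec solo? y z
          two : ∀ y → B y → 2 ≤ # (edge? y) + # (soloEdge? y)
          two y By with B-neighbour By (Ts.⊆T tW)
          ... | x , n with unique⊎2≤# (edge? y) (By , n)
          ...   | inj₂ h = ≤-trans h (m≤m+n _ _)
          ...   | inj₁ u = +-mono-≤ (∈⇒1≤# (edge? y) (By , n)) (∈⇒1≤# (soloEdge? y)
                             ((By , n) , proj₁ (proj₁ n) , λ { x′ (a , e) →
                                 u x′ (By , a , trans e (proj₂ n)) }))
          edges≤dB : ∀ z → # (λ y → edge? y z) ≤ dB z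
          edges≤dB z = #-mono (λ y → edge? y z) (λ y → (z ~? y) ×-dec B? y)
              (λ { y (By , (a , _) , _) → ~-sym a , By })
          atMost : t ≤ b → ∀ z → # (λ y → edge? y z) + # (λ y → soloEdge? y z) ≤ b + b
          atMost t≤b z with any? (λ y → soloEdge? y z)
          ... | yes (y , (By , (a , Az) , refl) , s) = +-mono-≤ (≤-trans (edges≤dB z) le)
                  (≤-trans (#-mono (λ y → soloEdge? y z) (λ y → edge? y z) (λ _ → proj₁))
                      (≤-trans (edges≤dB z) le))
            where le = solo-dB By Az tW s
          ... | no ¬s with any? (λ y → edge? y z)
          ...   | no ¬e = ≤-trans (≤-reflexive (cong₂ _+_
              (#-none (λ y → edge? y z) (λ y e → ¬e (y , e)))
                  (#-none (λ y → soloEdge? y z) (λ y e → ¬s (y , e))))) z≤n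
          ...   | yes (y , (By , (a , Az) , refl)) = ≤-trans
              (+-mono-≤ (≤-trans (edges≤dB z) (terminal-dB Az tW))
                    (≤-reflexive (#-none (λ y → soloEdge? y z) (λ y e → ¬s (y , e)))))
                        (≤-trans (≤-reflexive (+-identityʳ _)) (+-monoˡ-≤ b t≤b))
          outside : ∀ z → ¬ (A z × f z ≡ W) → # (λ y → edge? y z) + # (λ y → soloEdge? y z) ≡ 0
          outside z ¬z = cong₂ _+_ (#-none (λ y → edge? y z) (λ { y (_ , (_ , Az) , e) → ¬z (Az , e) }))
                                   (#-none (λ y → soloEdge? y z) (λ { y ((_ , (_ , Az) , e) , _) →
                                       ¬z (Az , e) }))

        TerminalSolo : Fin N → Fin N → Set
        TerminalSolo y z = (A z × Ts.Mem (f z)) × Solo y z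

        terminalSolo? : ∀ y z → Dec (TerminalSolo y z)
        terminalSolo? y z = (A? z ×-dec Ts.mem? (f z)) ×-dec solo? y z

        -- Each accessible class holds a neighbour of `y`, and each terminal class holds a second
        -- one or a solo neighbour; the degree bound does the rest.
        many-solo : ∀ {y} → B y → dB y + t < # (terminalSolo? y) + b
        many-solo {y} By = cancel-balance (dA y) (≤-trans
            (≤-reflexive (cong suc (sym (+-assoc (dA y) _ _))))
            (≤-trans (+-monoˡ-< t (degree-split (proj₁ By))) (≤-reflexive (shuffle (# T?) b t)))) (begin
            # T? + t                                              ≡⟨ sum-+ _ _ ⟨
            sum (λ c → χ (T? c) + χ (Ts.mem? c))                  ≤⟨ sum-mono-≤ bound ⟩
            sum (λ c → # (neighbours? y c) + # (solo-in? c))      ≡⟨ sum-+ _ _ ⟩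
            sum (λ c → # (neighbours? y c)) + sum (λ c → # (solo-in? c))
                ≡⟨ cong₂ _+_ (neighbours-sum y) (#-fibres (terminalSolo? y) f) ⟩
            dA y + # (terminalSolo? y)                            ∎)
          where
          open ≤-Reasoning
          shuffle : ∀ x b t → x + b + t ≡ x + t + b
          shuffle = solve-∀
          solo-in? : ∀ c → Decidable (λ z → TerminalSolo y z × f z ≡ c)
          solo-in? = class? (terminalSolo? y) f
          bound : ∀ c → χ (T? c) + χ (Ts.mem? c) ≤ # (neighbours? y c) + # (solo-in? c)
          bound c = go (T? c) (Ts.mem? c)
            where
            both : T.Mem c → Ts.Mem c → 2 ≤ # (neighbours? y c) + # (solo-in? c)
            both Tc m = let (x , n@((a , Ax) , fx≡c)) = B-neighbour By Tc in
              [ (λ u → +-mono-≤ (∈⇒1≤# (neighbours? y c) n) (∈⇒1≤# (solo-in? c)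
                  (((Ax , subst Ts.Mem (sym fx≡c) m) , a , λ x′ (h , e) → u x′ (h , trans e fx≡c)) , fx≡c)))
              , (λ h → ≤-trans h (m≤m+n _ _)) ]′ (unique⊎2≤# (neighbours? y c) n)
            go : (d : Dec (T.Mem c)) (e : Dec (Ts.Mem c)) → χ d + χ e ≤ # (neighbours? y c) + # (solo-in? c)
            go (no ¬t) (yes m) = ⊥-elim (¬t (Ts.⊆T m))
            go (no _)  (no _)  = z≤n
            go (yes Tc) (no _) = ≤-trans (∈⇒1≤# (neighbours? y c) (proj₂ (B-neighbour By Tc))) (m≤m+n _ _)
            go (yes Tc) (yes m) = both Tc m

        private
          module MI = MaximalIndependent (maximalIndependent B?)

        -- Weighing a maximal independent set of B by its solo neighbours gives more than the number
        -- of vertices in terminal classes.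
        crowded : ∃ λ z → 2 ≤ # (λ y → MI.I? y ×-dec terminalSolo? y z)
        crowded = decidable-stable (any? (λ z → 2 ≤? # (λ y → MI.I? y ×-dec terminalSolo? y z))) λ ¬h →
          <⇒≱ (begin-strict
            k * b + t * # MI.I?                     <⟨ +-monoˡ-< _ B-lower ⟩
            # B? + t * # MI.I?                      ≤⟨ +-monoˡ-≤ _ B≤ ⟩
            sum m + t * # MI.I?                     ≡⟨ trans (sum-+ _ _) (cong (sum m +_) (sum-*ˡ t _)) ⟨
            sum (λ y → m y + t * χ (MI.I? y))       ≤⟨ sum-mono-≤ weigh ⟩
            sum (λ y → g y + b * χ (MI.I? y))       ≡⟨ trans (sum-+ _ _) (cong (sum g +_) (sum-*ˡ b _)) ⟩
            sum g + b * # MI.I?                     ≤⟨ +-monoˡ-≤ _ (g≤ ¬h) ⟩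
            k * t + b * # MI.I?                     ∎) (rearrangement k≤I (<⇒≤ b<t))
          where
          open ≤-Reasoning
          g m : Fin N → ℕ
          g y = # (λ z → MI.I? y ×-dec terminalSolo? y z)
          dominated? : ∀ y x → Dec (MI.I y × (x ≡ y ⊎ (y ~ x × B x)))
          dominated? y x = MI.I? y ×-dec ((x ≟ y) ⊎-dec ((y ~? x) ×-dec B? x))
          m y = # (dominated? y)
          B≤ : # B? ≤ sum m
          B≤ = begin
            # B?                                     ≤⟨ sum-mono-≤
                (λ x → χ-≤ (B? x) (λ Bx → ∈⇒1≤# (λ y → dominated? y x) (proj₂ (cover Bx)))) ⟩
            sum (λ x → # (λ y → dominated? y x))     ≡⟨ sum-swap _ ⟩
            sum m                                    ∎
            where
            cover : ∀ {x} → B x → ∃ λ y → MI.I y × (x ≡ y ⊎ (y ~ x × B x))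
            cover {x} Bx with MI.maximal Bx
            ... | inj₁ i = x , i , inj₁ refl
            ... | inj₂ (y , i , a) = y , i , inj₂ (a , Bx)
          m≤ : ∀ {y} → m y ≤ suc (dB y)
          m≤ {y} = ≤-trans (#-cover (dominated? y) (_≟ y) (λ x → (y ~? x) ×-dec B? x) (λ _ → proj₂))
                           (≤-reflexive (cong (_+ dB y) (#-singleton y)))
          m-out : ∀ {y} → ¬ MI.I y → m y ≡ 0
          m-out {y} ¬i = #-none (dominated? y) (λ _ → ¬i ∘ proj₁)
          weigh : ∀ y → m y + t * χ (MI.I? y) ≤ g y + b * χ (MI.I? y)
          weigh y = χ-elim (MI.I? y) (λ i → m y + t * i ≤ g y + b * i)
            (λ i → begin
              m y + t * 1                   ≡⟨ cong (m y +_) (*-identityʳ t) ⟩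
              m y + t                       ≤⟨ +-monoˡ-≤ t m≤ ⟩
              suc (dB y + t)                ≤⟨ many-solo (MI.I⊆P i) ⟩
              # (terminalSolo? y) + b       ≤⟨ +-monoˡ-≤ b
                  (#-mono (terminalSolo? y) (λ z → MI.I? y ×-dec terminalSolo? y z) (λ _ → i ,_)) ⟩
              g y + b                       ≡⟨ cong (g y +_) (*-identityʳ b) ⟨
              g y + b * 1                   ∎)
            (λ ¬i → ≤-trans (≤-reflexive (cong₂ _+_ (m-out ¬i) (*-zeroʳ t))) z≤n)
          -- A member of the independent set dominates itself and fewer than `b` others, and more
          -- than `k * b` vertices must be dominated.
          k≤I : k ≤ # MI.I?
          k≤I = <⇒≤ (*-cancelʳ-< b k (# MI.I?) (begin-strict
            k * b                         <⟨ B-lower ⟩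
            # B?                          ≤⟨ B≤ ⟩
            sum m                         ≤⟨ sum-mono-≤ (λ y → χ-elim (MI.I? y) (λ i → m y ≤ b * i)
                                               (λ i → ≤-trans m≤ (≤-trans (dB<b (MI.I⊆P i))
                                                   (≤-reflexive (sym (*-identityʳ b)))))
                                               (λ ¬i → ≤-trans (≤-reflexive (m-out ¬i)) z≤n)) ⟩
            sum (λ y → b * χ (MI.I? y))   ≡⟨ sum-*ˡ b _ ⟩
            b * # MI.I?                   ≡⟨ *-comm b _ ⟩
            # MI.I? * b                   ∎))
          terminal? : Decidable (λ z → A z × Ts.Mem (f z))
          terminal? z = A? z ×-dec Ts.mem? (f z)
          -- If no `z` is shared, the sum is at most the number of vertices in the `t` terminal
          -- classes.
          g≤ : ¬ (∃ λ z → 2 ≤ # (λ y → MI.I? y ×-dec terminalSolo? y z)) → sum g ≤ k * t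
          g≤ ¬h = begin
            sum g                                                       ≡⟨ sum-swap _ ⟩
            sum (λ z → # (λ y → MI.I? y ×-dec terminalSolo? y z))       ≤⟨ sum-mono-≤ few ⟩
            # terminal?                                                 ≡⟨ #-fibres terminal? f ⟨
            sum (λ c → # (class? terminal? f c))
                ≤⟨ sum-mono-≤ (λ c → ≤-*χ (Ts.mem? c)
                (≤-trans (#-mono (class? terminal? f c) (class? R? f c)
                    (λ { x (((rx , _) , _) , e) → rx , e })) (bounded c))
                (λ ¬m → #-none (class? terminal? f c) (λ { x ((_ , m) , refl) → ¬m m }))) ⟩
            sum (λ c → k * χ (Ts.mem? c))                               ≡⟨ sum-*ˡ k _ ⟩
            k * t                                                       ∎
            where
            few : ∀ z → # (λ y → MI.I? y ×-dec terminalSolo? y z) ≤ χ (terminal? z)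
            few z = χ-elim (terminal? z) (# (λ y → MI.I? y ×-dec terminalSolo? y z) ≤_)
              (λ _ → s≤s⁻¹ (≰⇒> (λ h → ¬h (z , h))))
              (λ ¬z → ≤-reflexive (#-none (λ y → MI.I? y ×-dec terminalSolo? y z)
                  (λ { y (_ , tz , _) → ¬z tz })))

        record Shared : Set where
          field
            {z y₁ y₂}   : Fin N
            z∈A         : A z
            z-terminal  : Ts.Mem (f z)
            y₁∈B        : B y₁
            y₂∈B        : B y₂
            solo₁       : Solo y₁ z
            solo₂       : Solo y₂ z
            y₂≢y₁       : y₂ ≢ y₁
            nonadjacent : ¬ (y₁ ~ y₂)

        shared : Shared
        shared =
          let (z , h) = crowded
              (y₁ , y₂ , (i₁ , (Az , tz) , s₁) , (i₂ , _ , s₂) , ne) =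
                2≤#⇒∃₂ (λ y → MI.I? y ×-dec terminalSolo? y z) h
          in record { z∈A = Az ; z-terminal = tz ; y₁∈B = MI.I⊆P i₁ ; y₂∈B = MI.I⊆P i₂
                    ; solo₁ = s₁ ; solo₂ = s₂ ; y₂≢y₁ = ne ; nonadjacent = MI.indep i₁ i₂ }

    IH : Set₁
    IH = ∀ {P′ : Fin N → Set} (P′? : Decidable P′) {Q′ : Fin r → Set} (Q′? : Decidable Q′) →
         # P′? < # P? → # P′? ≤ k * # Q′? →
         (∀ {x} → P′ x → # (λ y → (x ~? y) ×-dec P′? y) < # Q′?) → ∃ (Proper P′? Q′)

    -- Exchanging a vertex of `B` with its solo neighbour.

    module Exchange (ih : IH) (v : Fin N) (Pv : P v) (f : Fin N → Fin r)
                    (col : Proper (rest? v) Q f) where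

      open State v Pv f col
      open Proper col

      -- B without y is recoloured with the inaccessible colours, y takes the place of z, and z becomes the
      -- uncoloured vertex.
      module Recolour (blocked : ∀ {c} → T.Mem c → ¬ Free (Rest v) f v c)
                      {y z} (By : B y) (Az : A z) (solo : Solo y z) where

        open Blocked blocked

        private
          R = Rest v
          R? = rest? v

        B⁻? : Decidable (λ x → B x × x ≢ y)
        B⁻? x = B? x ×-dec ¬? (x ≟ y)

        B⁻<B : # B⁻? < # B?
        B⁻<B = #-⊂ B⁻? B? (λ _ → proj₁) By (λ s → proj₂ s refl)

        abstract
          recoloured : ∃ (Proper B⁻? Inaccessible)
          recoloured = ih B⁻? inaccessible?
            (≤-trans B⁻<B (#-mono B? P? (λ _ → proj₁)))
            (s≤s⁻¹ (≤-trans B⁻<B B-upper))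
            (λ {x} (Bx , _) → ≤-<-trans (#-mono (λ w → (x ~? w) ×-dec B⁻? w) (λ w → (x ~? w) ×-dec B? w)
                                           (λ { _ (a , Bw , _) → a , Bw })) (dB<b Bx))

        g : Fin N → Fin r
        g = proj₁ recoloured

        module G = Proper (proj₂ recoloured)

        choose : ∀ x → Dec (x ≡ y) → Dec (B x) → Fin r
        choose x (yes _) _       = f z
        choose x (no _)  (yes _) = g x
        choose x (no _)  (no _)  = f x

        Origin : Fin N → Fin r → Set
        Origin x c = (x ≡ y × f z ≡ c) ⊎ ((B x × x ≢ y) × g x ≡ c) ⊎ (A x × f x ≡ c)

        abstract
          f* : Fin N → Fin r
          f* x = choose x (x ≟ y) (B? x)

          origin* : ∀ {x} → P x → Origin x (f* x)
          origin* {x} p = go (x ≟ y) (B? x)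
            where
            go : ∀ d e → Origin x (choose x d e)
            go (yes e) _        = inj₁ (e , refl)
            go (no ne) (yes Bx) = inj₂ (inj₁ ((Bx , ne) , refl))
            go (no ne) (no ¬B)  = inj₂ (inj₂ ([ id , ⊥-elim ∘ ¬B ]′ (A⊎B p) , refl))

          f*-A : ∀ {x} → A x → f* x ≡ f x
          f*-A {x} Ax = go (x ≟ y) (B? x)
            where
            go : ∀ d e → choose x d e ≡ f x
            go (yes refl) _       = ⊥-elim (B∌A By Ax)
            go (no _)    (yes Bx) = ⊥-elim (B∌A Bx Ax)
            go (no _)    (no _)   = refl

          f*-B : ∀ {x} → B x → x ≢ y → f* x ≡ g x
          f*-B {x} Bx x≢y = go (x ≟ y) (B? x)
            where
            go : ∀ d e → choose x d e ≡ g x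
            go (yes e) _        = ⊥-elim (x≢y e)
            go (no _) (yes _)   = refl
            go (no _) (no ¬B)   = ⊥-elim (¬B Bx)

        B⁻-inaccessible : ∀ {x c} → B x × x ≢ y → T.Mem c → g x ≢ c
        B⁻-inaccessible b Tc refl = proj₂ (G.inQ b) Tc

        private
          clash : ∀ {x x′ c} → x ≢ z → x′ ≢ z → x ~ x′ → Origin x c → Origin x′ c → ⊥
          clash _ _ a (inj₁ (refl , _)) (inj₁ (refl , _)) = ~-irrefl a
          clash _ _ a (inj₁ (refl , e)) (inj₂ (inj₁ (b , e′))) = B⁻-inaccessible b (proj₂ Az)
              (trans e′ (sym e))
          clash _ ne a (inj₁ (refl , e)) (inj₂ (inj₂ (Ax , e′))) = ne
              (proj₂ solo _ ((a , Ax) , trans e′ (sym e)))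
          clash _ _ a (inj₂ (inj₁ (b , e))) (inj₁ (refl , e′)) = B⁻-inaccessible b (proj₂ Az)
              (trans e (sym e′))
          clash _ _ a (inj₂ (inj₁ (b , e))) (inj₂ (inj₁ (b′ , e′))) = G.proper b b′ a (trans e (sym e′))
          clash _ _ a (inj₂ (inj₁ (b , e))) (inj₂ (inj₂ (Ax , e′))) = B⁻-inaccessible b (proj₂ Ax)
              (trans e (sym e′))
          clash ne _ a (inj₂ (inj₂ (Ax , e))) (inj₁ (refl , e′)) = ne
              (proj₂ solo _ ((~-sym a , Ax) , trans e (sym e′)))
          clash _ _ a (inj₂ (inj₂ (Ax , e))) (inj₂ (inj₁ (b , e′))) = B⁻-inaccessible b (proj₂ Ax)
              (trans e′ (sym e))
          clash _ _ a (inj₂ (inj₂ (Ax , e))) (inj₂ (inj₂ (Ax′ , e′))) = proper (proj₁ Ax)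
              (proj₁ Ax′) a (trans e (sym e′))

        class* : ∀ {x c} → Rest z x × f* x ≡ c → x ≢ z × Origin x c
        class* ((p , ne) , refl) = ne , origin* p

        -- With `stable⁺`: accessible classes other than `f z` keep their members, since `y`
        -- receives `f z` and the rest of `B` only inaccessible colours.
        stable⁻ : ∀ {x c} → T.Mem c → c ≢ f z → Rest z x × f* x ≡ c → R x × f x ≡ c
        stable⁻ Tc ne s with proj₂ (class* s)
        ... | inj₁ (_ , e)              = ⊥-elim (ne (sym e))
        ... | inj₂ (inj₁ (b , e))       = ⊥-elim (B⁻-inaccessible b Tc e)
        ... | inj₂ (inj₂ ((Rx , _) , e)) = Rx , e

        stable⁺ : ∀ {x c} → T.Mem c → x ≢ z → R x × f x ≡ c → Rest z x × f* x ≡ c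
        stable⁺ Tc ne (Rx , refl) = (proj₁ Rx , ne) , f*-A (Rx , Tc)

        size-fz : # (class? (rest? z) f* (f z)) ≤ # (class? R? f (f z))
        size-fz = +-cancelʳ-≤ 1 _ _ (begin
            # (class? (rest? z) f* (f z)) + 1       ≡⟨ cong (# (class? (rest? z) f* (f z)) +_)
                (#-singleton z) ⟨
            # (class? (rest? z) f* (f z)) + # (_≟ z) ≤⟨ #-disj (class? (rest? z) f* (f z))
                (_≟ z) union? sub sub-z (λ { _ s refl → proj₁ (class* s) refl }) ⟩
            # union?                                ≤⟨ #-cover union? (class? R? f (f z)) (_≟ y)
                (λ _ → id) ⟩
            # (class? R? f (f z)) + # (_≟ y)        ≡⟨ cong (# (class? R? f (f z)) +_) (#-singleton y) ⟩
            # (class? R? f (f z)) + 1               ∎)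
          where
          open ≤-Reasoning
          union? : Decidable (λ x → (R x × f x ≡ f z) ⊎ x ≡ y)
          union? x = class? R? f (f z) x ⊎-dec (x ≟ y)
          sub : ∀ x → Rest z x × f* x ≡ f z → (R x × f x ≡ f z) ⊎ x ≡ y
          sub x s with proj₂ (class* s)
          ... | inj₁ (e , _)                = inj₂ e
          ... | inj₂ (inj₁ (b , e))         = ⊥-elim (B⁻-inaccessible b (proj₂ Az) e)
          ... | inj₂ (inj₂ ((Rx , _) , e))  = inj₁ (Rx , e)
          sub-z : ∀ x → x ≡ z → (R x × f x ≡ f z) ⊎ x ≡ y
          sub-z _ refl = inj₁ (proj₁ Az , refl)

        col* : Proper (rest? z) Q f*
        col* = record { inQ = λ (p , _) → inQ* (origin* p)
                      ; proper = λ { (p , ne) (p′ , ne′) a e →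
                          clash ne ne′ a (subst (Origin _) e (origin* p)) (origin* p′) }
                      ; bounded = λ c → bounded* c (T? c) (c ≟ f z) }
          where
          inQ* : ∀ {x c} → Origin x c → Q c
          inQ* (inj₁ (_ , refl))            = T⊆Q (proj₂ Az)
          inQ* (inj₂ (inj₁ (b , refl)))     = proj₁ (G.inQ b)
          inQ* (inj₂ (inj₂ (Ax , refl)))    = inQ (proj₁ Ax)
          bounded* : ∀ c → Dec (T.Mem c) → Dec (c ≡ f z) → # (class? (rest? z) f* c) ≤ k
          bounded* c _ (yes refl) = ≤-trans size-fz (bounded c)
          bounded* c (yes Tc) (no ne) = ≤-trans (#-mono (class? (rest? z) f* c) (class? R? f c)
              (λ _ → stable⁻ Tc ne)) (bounded c)
          bounded* c (no ¬t) (no ne) = ≤-trans (#-mono (class? (rest? z) f* c) (class? B⁻? g c) sub)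
              (G.bounded c)
            where
            sub : ∀ x → Rest z x × f* x ≡ c → (B x × x ≢ y) × g x ≡ c
            sub x s with proj₂ (class* s)
            ... | inj₁ (_ , e)                  = ⊥-elim (ne (sym e))
            ... | inj₂ (inj₁ (b , e))           = b , e
            ... | inj₂ (inj₂ ((_ , Tx) , refl)) = ⊥-elim (¬t Tx)

        module S* = State z (proj₁ (proj₁ Az)) f* col*

        free-stable : ∀ {u c} → T.Mem c → c ≢ f z → Free R f u c → Free (Rest z) f* u c
        free-stable Tc ne free (x , s , a) = free (x , stable⁻ Tc ne s , a)

        -- A path to a sink that misses `f z` runs through classes untouched by the exchange.
        avoid⊆T* : ∀ {c} → Avoid.Mem (f z) c → S*.T.Mem c
        avoid⊆T* = Avoid.least (f z) S*.T.Mem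
          (λ { {c} ((Qc , h) , ne) → S*.T.base (Qc , ≤-<-trans
              (#-mono (class? (rest? z) f* c) (class? R? f c)
                  (λ _ → stable⁻ (T.base (Qc , h)) ne)) h) })
          (λ { ((x , s@(_ , e) , free) , ne) a T*d → let Td = avoid⊆T a in
               S*.T.step (x , stable⁺ (T.step (x , s , free) Td)
                   (λ { refl → ne (sym e) }) s , free-stable Td (avoid≢ a) free) T*d })

        module Grown (terminal : ∀ {c} → T.Mem c → c ≢ f z → Avoid.Mem (f z) c)
                     (unmovable : ∀ {c} → T.Mem c → c ≢ f z → ¬ Free R f z c)
                     {y′} (By′ : B y′) (solo′ : Solo y′ z) (y′≢y : y′ ≢ y) (nonadjacent : ¬ (y ~ y′)) where

          -- The vertex that could leave the class `f z` is not `z`, which is unmovable, so it is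
          -- still there and can still leave; a sink stays a sink because `y` merely replaces `z`.
          fz∈T* : S*.T.Mem (f z)
          fz∈T* with T.origin (proj₂ Az)
          ... | inj₁ (Qc , h) = S*.T.base (Qc , ≤-<-trans size-fz h)
          ... | inj₂ (d , (x , s , free) , Td , d<) =
                S*.T.step (x , stable⁺ (proj₂ Az) (λ { refl → unmovable Td d≢ free }) s ,
                    free-stable Td d≢ free)
                          (avoid⊆T* (terminal Td d≢))
            where
            d≢ : d ≢ f z
            d≢ refl = <-irrefl refl d<

          T⊆T* : ∀ {c} → T.Mem c → S*.T.Mem c
          T⊆T* {c} Tc with c ≟ f z
          ... | yes refl = fz∈T*
          ... | no ne    = avoid⊆T* (terminal Tc ne)

          y′-free : Free (Rest z) f* y′ (f z)
          y′-free (x , s , a) with class* s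
          ... | _  , inj₁ (refl , _)          = nonadjacent (~-sym a)
          ... | _  , inj₂ (inj₁ (b , e))      = B⁻-inaccessible b (proj₂ Az) e
          ... | ne , inj₂ (inj₂ (Ax , e))     = ne (proj₂ solo′ x ((a , Ax) , e))

          -- `y′` may now enter `f z`: its only neighbour there has left and the newcomer `y` is not
          -- adjacent to it. Hence the new class of `y′`, formerly inaccessible, becomes accessible.
          grown : # T? < # S*.T?
          grown = #-⊂ T? S*.T? {f* y′} (λ _ → T⊆T*)
            (S*.T.step (y′ , ((proj₁ By′ , λ { refl → B∌A By′ Az }) , refl) , y′-free) fz∈T*)
            (λ Ty → B⁻-inaccessible (By′ , y′≢y) Ty (sym (f*-B By′ y′≢y)))

    -- Growing the accessible set, and induction on the number of vertices.

    module Loop (ih : IH) where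

      Larger : ℕ → Set
      Larger m = ∃ λ z → Σ (P z) λ Pz → ∃ λ g → Σ (Proper (rest? z) Q g) λ col → m < # (State.T? z Pz g col)

      module _ (v : Fin N) (Pv : P v) (f : Fin N → Fin r) (col : Proper (rest? v) Q f) where
        open State v Pv f col

        -- If a solo neighbour `z` in a terminal class can move to another accessible class `c`, the
        -- exchange makes `z` the uncoloured vertex; `c` is still accessible, as it has a path
        -- avoiding `f z`, so shifting finishes. If no such `z` can move, the count yields two
        -- nonadjacent vertices sharing a solo neighbour, and the accessible set grows.
        improve-blocked : (∀ {c} → T.Mem c → ¬ Free (Rest v) f v c) → ∃ (Proper P? Q) ⊎ Larger (# T?)
        improve-blocked blocked = go (any? λ z → any? λ y → any? λ c → (A? z ×-dec Ts.mem? (f z)) ×-dec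
            ((B? y ×-dec solo? y z) ×-dec ((T? c ×-dec ¬? (c ≟ f z)) ×-dec free? (rest? v) f z c)))
          where
          module Ts = Terminals terminals
          go : Dec (∃ λ z → ∃ λ y → ∃ λ c → (A z × Ts.Mem (f z)) × (B y × Solo y z) ×
              (T.Mem c × c ≢ f z) × Free (Rest v) f z c) →
               ∃ (Proper P? Q) ⊎ Larger (# T?)
          go (yes (z , y , c , (Az , tz) , (By , s) , (Tc , ne) , free)) =
            inj₁ (E.S*.finish (E.avoid⊆T* (Ts.terminal tz Tc ne)) (E.free-stable Tc ne free))
            where module E = Exchange.Recolour ih v Pv f col blocked By Az s
          go (no ¬m) = inj₂ (_ , proj₁ (proj₁ z∈A) , _ , E.col* , Gr.grown)
            where
            unmovable : ∀ {y z c} → B y → A z → Ts.Mem (f z) → Solo y z → T.Mem c → c ≢ f z →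
                ¬ Free (Rest v) f z c
            unmovable By Az tz s Tc ne free = ¬m (_ , _ , _ , (Az , tz) , (By , s) , (Tc , ne) , free)
            open SoloCount blocked terminals unmovable using (module Shared; shared)
            open Shared shared
            module E = Exchange.Recolour ih v Pv f col blocked y₁∈B z∈A solo₁
            module Gr = E.Grown (Ts.terminal z-terminal) (unmovable y₁∈B z∈A z-terminal solo₁)
                                y₂∈B solo₂ y₂≢y₁ nonadjacent

        improve : ∃ (Proper P? Q) ⊎ Larger (# T?)
        improve = go (any? (λ c → T? c ×-dec free? (rest? v) f v c))
          where
          go : Dec (∃ λ c → T.Mem c × Free (Rest v) f v c) → ∃ (Proper P? Q) ⊎ Larger (# T?)
          go (yes (c , Tc , free)) = inj₁ (finish Tc free)
          go (no ¬p) = improve-blocked (λ Tc free → ¬p (_ , Tc , free))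

      loop : ∀ fuel v Pv f col → r < # (State.T? v Pv f col) + fuel → ∃ (Proper P? Q)
      loop zero v Pv f col h = ⊥-elim (<⇒≱ h (≤-trans (≤-reflexive (+-identityʳ _))
          (#-≤ (State.T? v Pv f col))))
      loop (suc fuel) v Pv f col h = [ id , (λ (z , Pz , g , col′ , m<) → loop fuel z Pz g col′
        (≤-trans h (≤-trans (≤-reflexive (+-suc _ fuel)) (+-monoˡ-≤ fuel m<)))) ]′ (improve v Pv f col)

  hajnal-szemerédi : (Fin N → Fin r) → ∀ {P : Fin N → Set} (P? : Decidable P) {Q : Fin r → Set}
      (Q? : Decidable Q) →
       # P? ≤ k * # Q? →
       (∀ {x} → P x → # (λ y → (x ~? y) ×-dec P? y) < # Q?) → ∃ (Proper P? Q)
  hajnal-szemerédi default P? Q? = go P? Q? (<-wellFounded (# P?))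
    where
    go : ∀ {P : Fin N → Set} (P? : Decidable P) {Q : Fin r → Set} (Q? : Decidable Q) → Acc _<_ (# P?) →
         # P? ≤ k * # Q? →
         (∀ {x} → P x → # (λ y → (x ~? y) ×-dec P? y) < # Q?) → ∃ (Proper P? Q)
    go {P} P? {Q} Q? (acc rs) size deg = start (any? P?)
      where
      open Step P? Q? size deg
      start : Dec (∃ P) → ∃ (Proper P? Q)
      -- With no vertex in `P` the values are irrelevant; `default` only supplies a function.
      start (no ¬p) = default , record
        { inQ = λ p → ⊥-elim (¬p (_ , p)) ; proper = λ p → ⊥-elim (¬p (_ , p))
        ; bounded = λ c → ≤-trans (≤-reflexive (#-none (class? P? default c)
            (λ _ (p , _) → ¬p (_ , p)))) z≤n }
      start (yes (v , Pv)) = Loop.loop (λ P′? Q′? lt → go P′? Q′? (rs lt)) (suc r) v Pv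
          (proj₁ smaller) (proj₂ smaller) (m≤n+m _ _)
        where
        lt : # (rest? v) < # P?
        lt = #-⊂ (rest? v) P? (λ _ → proj₁) Pv (λ s → proj₂ s refl)
        smaller : ∃ (Proper (rest? v) Q)
        smaller = go (rest? v) Q? (rs lt) (≤-trans (<⇒≤ lt) size)
          (λ {x} (p , _) → ≤-<-trans (#-mono (λ y → (x ~? y) ×-dec rest? v y) (λ y → (x ~? y) ×-dec P? y)
                                         (λ { _ (a , q , _) → a , q })) (deg p))

-- Edge counts of closures and the transposition of two colours.

module _ {n} {S : Fin n → Set} {E : Fin n → Fin n → Set} (S? : Decidable S) (E? : ∀ i j → Dec (E i j))
         (E-sym : ∀ {i j} → E i j → E j i) (cl : Closure S E) where
  open Closure cl

  -- Every member outside S has an edge to a member of smaller rank; each such edge is counted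
  -- at both ends.
  closure-edges : # mem? + # mem? ≤ sum (λ i → # (λ j → mem? i ×-dec E? i j)) + (# S? + # S?)
  closure-edges = begin
      # mem? + # mem?                          ≤⟨ +-mono-≤ half half ⟩
      (X + # S?) + (X + # S?)                  ≡⟨ regroup X (# S?) ⟩
      (X + X) + (# S? + # S?)                  ≤⟨ +-monoˡ-≤ _ doubled ⟩
      sum (λ i → # (λ j → mem? i ×-dec E? i j)) + (# S? + # S?) ∎
    where
    open ≤-Reasoning
    regroup : ∀ x s → (x + s) + (x + s) ≡ (x + x) + (s + s)
    regroup = solve-∀
    down? : ∀ i j → Dec ((Mem i × Mem j) × E i j × rank j < rank i)
    down? i j = (mem? i ×-dec mem? j) ×-dec (E? i j ×-dec (rank j <? rank i))
    X = sum (λ i → # (down? i))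
    half : # mem? ≤ X + # S?
    half = ≤-trans (sum-mono-≤ (λ i → χ-≤ (mem? i) λ m →
        [ (λ s → ≤-trans (1≤χ (S? i) s) (m≤n+m _ _))
        , (λ (j , e , mj , lt) → ≤-trans (∈⇒1≤# (down? i) ((m , mj) , e , lt)) (m≤m+n _ _)) ]′ (origin m)))
      (≤-reflexive (sum-+ _ _))
    doubled : X + X ≤ sum (λ i → # (λ j → mem? i ×-dec E? i j))
    doubled = begin
      X + X                                                ≡⟨ cong (X +_) (sum-swap _) ⟩
      X + sum (λ i → # (λ j → down? j i))                  ≡⟨ sum-+ _ _ ⟨
      sum (λ i → # (down? i) + # (λ j → down? j i))
          ≤⟨ sum-mono-≤ (λ i → #-disj (down? i) (λ j → down? j i) (λ j → mem? i ×-dec E? i j)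
          (λ { _ ((m , _) , e , _) → m , e }) (λ { _ ((_ , m) , e , _) → m , E-sym e })
              (λ { _ (_ , _ , lt) (_ , _ , gt) → <-asym lt gt })) ⟩
      sum (λ i → # (λ j → mem? i ×-dec E? i j))            ∎

module Transposition {n} (α β : Fin n) where

  τ : Fin n → Fin n
  τ a with a ≟ α | a ≟ β
  ... | yes _ | _     = β
  ... | no _  | yes _ = α
  ... | no _  | no _  = a

  τ-α : τ α ≡ β
  τ-α with α ≟ α
  ... | yes _ = refl
  ... | no ne = ⊥-elim (ne refl)

  τ-β : τ β ≡ α
  τ-β with β ≟ α | β ≟ β
  ... | yes e | _     = e
  ... | no _  | yes _ = refl
  ... | no _  | no ne = ⊥-elim (ne refl)

  τ-other : ∀ {a} → ¬ (a ≡ α ⊎ a ≡ β) → τ a ≡ a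
  τ-other {a} h with a ≟ α | a ≟ β
  ... | yes e | _     = ⊥-elim (h (inj₁ e))
  ... | no _  | yes e = ⊥-elim (h (inj₂ e))
  ... | no _  | no _  = refl

  τ-involutive : ∀ a → τ (τ a) ≡ a
  τ-involutive a = go (a ≟ α) (a ≟ β)
    where
    go : Dec (a ≡ α) → Dec (a ≡ β) → τ (τ a) ≡ a
    go (yes refl) _          = trans (cong τ τ-α) τ-β
    go (no _)     (yes refl) = trans (cong τ τ-β) τ-α
    go (no p)     (no q)     = trans (cong τ (τ-other [ p , q ]′)) (τ-other [ p , q ]′)

  τ-injective : ∀ {a b} → τ a ≡ τ b → a ≡ b
  τ-injective e = trans (sym (τ-involutive _)) (trans (cong τ e) (τ-involutive _))

-- Partial total colourings: setting an edge and swapping two colours.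

module TotalColourings
  {N C : ℕ} (k : ℕ)
  (_~_ : Fin N → Fin N → Set) (_~?_ : ∀ x y → Dec (x ~ y))
  (~-sym : ∀ {x y} → x ~ y → y ~ x) (~-irrefl : ∀ {x} → ¬ (x ~ x))
  where

  -- All vertices are coloured, but only the edges in H; c is junk elsewhere.
  record Colouring (H : Fin N → Fin N → Set) : Set where
    field
      φ     : Fin N → Fin C
      c     : Fin N → Fin N → Fin C
      c-sym : ∀ {u w} → H u w → c u w ≡ c w u
      vv    : ∀ {u w} → u ~ w → φ u ≢ φ w
      ee    : ∀ {u w x} → H u w → H u x → c u w ≡ c u x → w ≡ x
      ve    : ∀ {u w} → H u w → c u w ≢ φ u
      small : ∀ a → # (λ u → φ u ≟ a) ≤ k

    Missing : Fin N → Fin C → Set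
    Missing u a = φ u ≢ a × (∀ w → H u w → c u w ≢ a)

  open Colouring

  restrict : ∀ {H H′ : Fin N → Fin N → Set} → (∀ {u w} → H u w → H′ u w) → Colouring H′ → Colouring H
  restrict sub κ = record
    { φ = φ κ ; c = c κ ; c-sym = c-sym κ ∘ sub ; vv = vv κ
    ; ee = λ h h′ → ee κ (sub h) (sub h′) ; ve = ve κ ∘ sub ; small = small κ }

  Pair : Fin N → Fin N → Fin N → Fin N → Set
  Pair v w x y = (x ≡ v × y ≡ w) ⊎ (x ≡ w × y ≡ v)

  pair? : ∀ v w x y → Dec (Pair v w x y)
  pair? v w x y = ((x ≟ v) ×-dec (y ≟ w)) ⊎-dec ((x ≟ w) ×-dec (y ≟ v))

  pair-sym : ∀ {v w x y} → Pair v w x y → Pair v w y x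
  pair-sym (inj₁ (p , q)) = inj₂ (q , p)
  pair-sym (inj₂ (p , q)) = inj₁ (q , p)

  module SetEdge {H : Fin N → Fin N → Set} (κ : Colouring H) {v w γ} (v≢w : v ≢ w)
                 (mv : Missing κ v γ) (mw : Missing κ w γ) where

    private
      pick : Fin N → Fin N → ∀ {A : Set} → Dec A → Fin C
      pick x y (yes _) = γ
      pick x y (no _)  = c κ x y

    abstract
      c⁺ : Fin N → Fin N → Fin C
      c⁺ x y = pick x y (pair? v w x y)

      c⁺-pair : ∀ {x y} → Pair v w x y → c⁺ x y ≡ γ
      c⁺-pair {x} {y} p with pair? v w x y
      ... | yes _ = refl
      ... | no ¬p = ⊥-elim (¬p p)

      c⁺-other : ∀ {x y} → ¬ Pair v w x y → c⁺ x y ≡ c κ x y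
      c⁺-other {x} {y} ¬p with pair? v w x y
      ... | yes p = ⊥-elim (¬p p)
      ... | no _  = refl

    private
      H⁺ : Fin N → Fin N → Set
      H⁺ x y = H x y ⊎ Pair v w x y

      missing-pair : ∀ {x y} → Pair v w x y → Missing κ x γ
      missing-pair (inj₁ (refl , _)) = mv
      missing-pair (inj₂ (refl , _)) = mw

      pair-unique : ∀ {x y z} → Pair v w x y → Pair v w x z → y ≡ z
      pair-unique (inj₁ (_ , refl))    (inj₁ (_ , refl)) = refl
      pair-unique (inj₂ (_ , refl))    (inj₂ (_ , refl)) = refl
      pair-unique (inj₁ (refl , refl)) (inj₂ (e , _))    = ⊥-elim (v≢w e)
      pair-unique (inj₂ (refl , refl)) (inj₁ (e , _))    = ⊥-elim (v≢w (sym e))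

      status : ∀ {x y} → H⁺ x y → (Pair v w x y × c⁺ x y ≡ γ) ⊎ (¬ Pair v w x y × H x y × c⁺ x y ≡ c κ x y)
      status {x} {y} h with pair? v w x y
      ... | yes p = inj₁ (p , c⁺-pair p)
      ... | no ¬p = inj₂ (¬p , [ id , ⊥-elim ∘ ¬p ]′ h , c⁺-other ¬p)

    -- Serves both to colour a new edge and, after restriction to `H`, to recolour an edge of `H`
    -- during a rotation.
    coloured : Colouring H⁺
    coloured = record
      { φ = φ κ ; c = c⁺ ; c-sym = c⁺-sym ; vv = vv κ ; ee = ee⁺ ; ve = ve⁺ ; small = small κ }
      where
      c⁺-sym : ∀ {x y} → H⁺ x y → c⁺ x y ≡ c⁺ y x
      c⁺-sym h with status h
      ... | inj₁ (p , e)      = trans e (sym (c⁺-pair (pair-sym p)))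
      ... | inj₂ (¬p , h′ , e) = trans e (trans (c-sym κ h′) (sym (c⁺-other (¬p ∘ pair-sym))))
      ee⁺ : ∀ {x y z} → H⁺ x y → H⁺ x z → c⁺ x y ≡ c⁺ x z → y ≡ z
      ee⁺ h h′ e with status h | status h′
      ... | inj₁ (p , _)      | inj₁ (q , _)      = pair-unique p q
      ... | inj₁ (p , e₁)     | inj₂ (_ , g , e₂) = ⊥-elim
          (proj₂ (missing-pair p) _ g (trans (sym e₂) (trans (sym e) e₁)))
      ... | inj₂ (_ , g , e₁) | inj₁ (q , e₂)     = ⊥-elim
          (proj₂ (missing-pair q) _ g (trans (sym e₁) (trans e e₂)))
      ... | inj₂ (_ , g , e₁) | inj₂ (_ , g′ , e₂) = ee κ g g′ (trans (sym e₁) (trans e e₂))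
      ve⁺ : ∀ {x y} → H⁺ x y → c⁺ x y ≢ φ κ x
      ve⁺ h e with status h
      ... | inj₁ (p , e₁)     = proj₁ (missing-pair p) (trans (sym e) e₁)
      ... | inj₂ (_ , g , e₁) = ve κ g (trans (sym e₁) e)

  -- The hypothesis hub makes the swap act on all vertices coloured α or β, or on none of them.
  module Swap {H : Fin N → Fin N → Set} (H-sym : ∀ {u w} → H u w → H w u) (κ : Colouring H) (α β : Fin C)
    {K : Fin N → Set} (K? : Decidable K)
    (closed : ∀ {u w} → H u w → c κ u w ≡ α ⊎ c κ u w ≡ β → K u → K w)
    (hub : (∀ u → φ κ u ≡ α ⊎ φ κ u ≡ β → K u) ⊎ (∀ u → φ κ u ≡ α ⊎ φ κ u ≡ β → ¬ K u))
    where

    open Transposition α β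

    private
      apply : ∀ {A : Set} → Dec A → Fin C → Fin C
      apply (yes _) = τ
      apply (no _)  = id

      apply-injective : ∀ {A : Set} (d : Dec A) {a b} → apply d a ≡ apply d b → a ≡ b
      apply-injective (yes _) = τ-injective
      apply-injective (no _)  = id

      apply-other : ∀ {A : Set} (d : Dec A) {a} → ¬ (a ≡ α ⊎ a ≡ β) → apply d a ≡ a
      apply-other (yes _) = τ-other
      apply-other (no _)  _ = refl

      apply-yes : ∀ {A : Set} (d : Dec A) {a} → A → apply d a ≡ τ a
      apply-yes (yes _) _ = refl
      apply-yes (no ¬x) x = ⊥-elim (¬x x)

      apply-no : ∀ {A : Set} (d : Dec A) {a} → ¬ A → apply d a ≡ a
      apply-no (yes x) ¬x = ⊥-elim (¬x x)
      apply-no (no _)  _  = refl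

    φ′ : Fin N → Fin C
    φ′ u = apply (K? u) (φ κ u)

    c′ : Fin N → Fin N → Fin C
    c′ u w = apply (K? u) (c κ u w)

    private
      special? : ∀ a → Dec (a ≡ α ⊎ a ≡ β)
      special? a = (a ≟ α) ⊎-dec (a ≟ β)

      -- Edges of `~` may join `K` to its complement, so `vv` needs a description of `φ′` that does
      -- not mention `K`.
      φ′-uniform : (∀ u → φ′ u ≡ τ (φ κ u)) ⊎ (∀ u → φ′ u ≡ φ κ u)
      φ′-uniform = [ (λ h → inj₁ (λ u → all h u (special? (φ κ u)))) ,
          (λ h → inj₂ (λ u → none h u (special? (φ κ u)))) ]′ hub
        where
        all : (∀ u → φ κ u ≡ α ⊎ φ κ u ≡ β → K u) → ∀ u → Dec (φ κ u ≡ α ⊎ φ κ u ≡ β) → φ′ u ≡ τ (φ κ u)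
        all h u (yes s) = apply-yes (K? u) (h u s)
        all h u (no ¬s) = trans (apply-other (K? u) ¬s) (sym (τ-other ¬s))
        none : (∀ u → φ κ u ≡ α ⊎ φ κ u ≡ β → ¬ K u) → ∀ u → Dec (φ κ u ≡ α ⊎ φ κ u ≡ β) → φ′ u ≡ φ κ u
        none h u (yes s) = apply-no (K? u) (h u s)
        none h u (no ¬s) = apply-other (K? u) ¬s

    swapped : Colouring H
    swapped = record
      { φ = φ′ ; c = c′
      ; c-sym = λ {u} {w} h → c′-sym h (K? u) (K? w) (special? (c κ u w))
      ; vv = λ a e → vv κ a ([ (λ h → τ-injective (trans (sym (h _)) (trans e (h _)))) ,
          (λ h → trans (sym (h _)) (trans e (h _))) ]′ φ′-uniform)
      ; ee = λ {u} h h′ e → ee κ h h′ (apply-injective (K? u) e)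
      ; ve = λ {u} h e → ve κ h (apply-injective (K? u) e)
      ; small = λ a → [ (λ h → ≤-trans (#-mono (λ u → φ′ u ≟ a) (λ u → φ κ u ≟ τ a)
          (λ u e → trans (sym (τ-involutive _)) (cong τ (trans (sym (h u)) e)))) (small κ (τ a)))
                      , (λ h → ≤-trans (#-mono (λ u → φ′ u ≟ a) (λ u → φ κ u ≟ a)
                          (λ u e → trans (sym (h u)) e)) (small κ a)) ]′ φ′-uniform
      }
      where
      c′-sym : ∀ {u w} → H u w → (d : Dec (K u)) (e : Dec (K w)) → Dec (c κ u w ≡ α ⊎ c κ u w ≡ β) →
          apply d (c κ u w) ≡ apply e (c κ w u)
      c′-sym h (yes _) (yes _) _ = cong τ (c-sym κ h)
      c′-sym h (no _)  (no _)  _ = c-sym κ h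
      c′-sym h d e (no ¬s) = trans (apply-other d ¬s)
          (trans (c-sym κ h) (sym (apply-other e (¬s ∘ subst (λ a → a ≡ α ⊎ a ≡ β) (sym (c-sym κ h))))))
      c′-sym h (yes u) (no ¬w) (yes s) = ⊥-elim (¬w (closed h s u))
      c′-sym h (no ¬u) (yes w) (yes s) = ⊥-elim (¬u (closed (H-sym h)
          (subst (λ a → a ≡ α ⊎ a ≡ β) (c-sym κ h) s) w))

    missing-outside : ∀ {u a} → ¬ K u → Missing κ u a → Missing swapped u a
    missing-outside {u} ¬u (m , n) = (λ e → m (trans (sym (apply-no (K? u) ¬u)) e)) ,
                                     (λ w h e → n w h (trans (sym (apply-no (K? u) ¬u)) e))

    missing-inside : ∀ {u a} → K u → Missing κ u a → Missing swapped u (τ a)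
    missing-inside {u} Ku (m , n) = (λ e → m (τ-injective (trans (sym (apply-yes (K? u) Ku)) e))) ,
                                    (λ w h e → n w h (τ-injective (trans (sym (apply-yes (K? u) Ku)) e)))

    missing-neither : ∀ {u a} → ¬ Missing κ u α → ¬ Missing κ u β → Missing κ u a → Missing swapped u a
    missing-neither {u} {a} ¬α ¬β m = go (K? u)
      where
      go : Dec (K u) → Missing swapped u a
      go (no ¬u) = missing-outside ¬u m
      go (yes Ku) = subst (Missing swapped u) (τ-other
          [ (λ { refl → ¬α m }) , (λ { refl → ¬β m }) ]′) (missing-inside Ku m)

    c′-outside : ∀ {u w} → ¬ K u → c′ u w ≡ c κ u w
    c′-outside {u} ¬u = apply-no (K? u) ¬u

  module Extension
    (D : ℕ) (degree≤D : ∀ u → # (u ~?_) ≤ D) (1≤k : 1 ≤ k) (C≡ : C ≡ D + 2 * k)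
    where

    -- Vizing fans at an end of the uncoloured edge.

    module Vizing {H : Fin N → Fin N → Set} (H? : ∀ u w → Dec (H u w))
      (H-sym : ∀ {u w} → H u w → H w u) (H⊆~ : ∀ {u w} → H u w → u ~ w)
      (κ₀ : Colouring H) {v w₀ : Fin N} (v~w₀ : v ~ w₀) (¬Hvw₀ : ¬ H v w₀)
      where

      H⁺ : Fin N → Fin N → Set
      H⁺ x y = H x y ⊎ Pair v w₀ x y

      missing? : ∀ u a → Dec (Missing κ₀ u a)
      missing? u a = ¬? (φ κ₀ u ≟ a) ×-dec all? (λ w → H? u w →-dec ¬? (c κ₀ u w ≟ a))

      abstract
        -- All fans starting at `w₀` at once, as a tree: the parent of `w′` misses the colour of the
        -- edge `v w′`. Maximality is built in, since a coloured edge at `v` whose colour is missing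
        -- at a member leads to a member.
        fan : Closure (_≡ w₀) (λ w′ w → H v w′ × Missing κ₀ w (c κ₀ v w′))
        fan = closure (_≟ w₀) (λ w′ w → H? v w′ ×-dec missing? w (c κ₀ v w′))

      module F = Closure fan

      fan≢v : ∀ {u} → F.Mem u → u ≢ v
      fan≢v m refl with F.origin m
      ... | inj₁ refl              = ~-irrefl v~w₀
      ... | inj₂ (_ , (h , _) , _) = ~-irrefl (H⊆~ h)

      -- Giving γ to the edge vw frees its old colour at v, which is missing at the predecessor of w.
      rotate : ∀ {w γ} → Acc _<_ (F.rank w) → F.Mem w → (κ : Colouring H) → Missing κ v γ → Missing κ w γ →
               (∀ {u a} → F.Mem u → F.rank u < F.rank w → Missing κ₀ u a → Missing κ u a) →
               (∀ {u} → F.rank u ≤ F.rank w → c κ v u ≡ c κ₀ v u) → Colouring H⁺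
      rotate {w} {γ} (acc rs) m κ mv mw keep same with F.origin m
      ... | inj₁ refl = SetEdge.coloured κ (λ { refl → ~-irrefl v~w₀ }) mv mw
      ... | inj₂ (p , (Hvw , miss-p) , Fp , p<w) =
        rotate (rs p<w) Fp κ′ (φ≢ , edge≢) (miss′ (fan≢v Fp) p≢w (keep Fp p<w miss-p))
          (λ {u} Fu u<p → miss′ (fan≢v Fu) (λ { refl → <-asym u<p p<w }) ∘ keep Fu (<-trans u<p p<w))
          (λ {u} u≤p → trans (S.c⁺-other (λ { (inj₁ (_ , refl)) → <⇒≱ p<w u≤p ; (inj₂ (e , _)) → v≢w e }))
                             (same (≤-trans u≤p (<⇒≤ p<w))))
        where
        v≢w : v ≢ w
        v≢w e = fan≢v m (sym e)
        p≢w : p ≢ w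
        p≢w refl = <-irrefl refl p<w
        module S = SetEdge κ v≢w mv mw
        κ′ : Colouring H
        κ′ = restrict inj₁ S.coloured
        vw≡ : c κ v w ≡ c κ₀ v w
        vw≡ = same ≤-refl
        φ≢ : φ κ v ≢ c κ₀ v w
        φ≢ e = ve κ Hvw (trans vw≡ (sym e))
        edge≢ : ∀ u → H v u → S.c⁺ v u ≢ c κ₀ v w
        edge≢ u h e = go (pair? v w v u)
          where
          go : Dec (Pair v w v u) → ⊥
          go (yes q) = proj₂ mv w Hvw (trans vw≡ (trans (sym e) (S.c⁺-pair q)))
          go (no ¬q) = ¬q (inj₁ (refl , ee κ h Hvw (trans (sym (S.c⁺-other ¬q)) (trans e (sym vw≡)))))
        miss′ : ∀ {u a} → u ≢ v → u ≢ w → Missing κ u a → Missing κ′ u a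
        miss′ u≢v u≢w (n , n′) = n , λ x h e → n′ x h (trans
            (sym (S.c⁺-other [ u≢v ∘ proj₁ , u≢w ∘ proj₁ ]′)) e)

      finish : ∀ {w γ} → F.Mem w → Missing κ₀ v γ → Missing κ₀ w γ → Colouring H⁺
      finish m mv mw = rotate (<-wellFounded _) m κ₀ mv mw (λ _ _ → id) (λ _ → refl)

      dH : Fin N → ℕ
      dH u = # (H? u)

      dH≤D : ∀ u → dH u ≤ D
      dH≤D u = ≤-trans (#-mono (H? u) (u ~?_) (λ _ → H⊆~)) (degree≤D u)

      dH<D : ∀ {u w} → u ~ w → ¬ H u w → dH u < D
      dH<D {u} a ¬h = ≤-trans (#-⊂ (H? u) (u ~?_) (λ _ → H⊆~) a ¬h) (degree≤D u)

      coloured? : ∀ u a → Decidable (λ w → H u w × c κ₀ u w ≡ a)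
      coloured? u a w = H? u w ×-dec (c κ₀ u w ≟ a)

      not-missing : ∀ {u a} → ¬ Missing κ₀ u a → φ κ₀ u ≡ a ⊎ ∃ λ w → H u w × c κ₀ u w ≡ a
      not-missing {u} {a} ¬m = go (φ κ₀ u ≟ a) (any? (coloured? u a))
        where
        go : Dec (φ κ₀ u ≡ a) → Dec (∃ λ w → H u w × c κ₀ u w ≡ a) → φ κ₀ u ≡ a ⊎ ∃ λ w →
            H u w × c κ₀ u w ≡ a
        go (yes e) _       = inj₁ e
        go (no _)  (yes w) = inj₂ w
        go (no ¬e) (no ¬w) = ⊥-elim (¬m (¬e , λ w h e → ¬w (w , h , e)))

      missing-count : ∀ u → C ≤ # (missing? u) + suc (dH u)
      missing-count u = begin
        C                                                       ≡⟨ trans (sum-const C 1) (*-identityʳ C) ⟨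
        sum {C} (λ _ → 1)
            ≤⟨ sum-mono-≤ (λ a → go a (toSum (missing? u a))) ⟩
        sum (λ a → χ (missing? u a) + (χ (a ≟ φ κ₀ u) + # (coloured? u a))) ≡⟨ sum-+ _ _ ⟩
        # (missing? u) + sum (λ a → χ (a ≟ φ κ₀ u) + # (coloured? u a))
            ≡⟨ cong (# (missing? u) +_) (sum-+ _ _) ⟩
        # (missing? u) + (# (_≟ φ κ₀ u) + sum (λ a → # (coloured? u a)))
            ≡⟨ cong (# (missing? u) +_) (cong₂ _+_ (#-singleton (φ κ₀ u)) (#-fibres (H? u) (c κ₀ u))) ⟩
        # (missing? u) + suc (dH u)                             ∎
        where
        open ≤-Reasoning
        go : ∀ a → Missing κ₀ u a ⊎ ¬ Missing κ₀ u a →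
            1 ≤ χ (missing? u a) + (χ (a ≟ φ κ₀ u) + # (coloured? u a))
        go a (inj₁ m) = ≤-trans (1≤χ (missing? u a) m) (m≤m+n _ _)
        go a (inj₂ ¬m) = ≤-trans ([ (λ e → ≤-trans (1≤χ (a ≟ φ κ₀ u) (sym e)) (m≤m+n _ _))
                                  , (λ (w , h) → ≤-trans (∈⇒1≤# (coloured? u a) h) (m≤n+m _ _)) ]′
                                      (not-missing ¬m)) (m≤n+m _ (χ (missing? u a)))

      -- An uncoloured edge at `u` saves one colour compared with `missing-some`; at `w₀` this unit
      -- makes the inequality in `popular` strict.
      missing-many : ∀ {u w} → u ~ w → ¬ H u w → 2 * k ≤ # (missing? u)
      missing-many {u} a ¬h = +-cancelʳ-≤ D _ _ (begin
        2 * k + D                      ≡⟨ trans (+-comm (2 * k) D) (sym C≡) ⟩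
        C                              ≤⟨ missing-count u ⟩
        # (missing? u) + suc (dH u)    ≤⟨ +-monoʳ-≤ _ (dH<D a ¬h) ⟩
        # (missing? u) + D             ∎)
        where open ≤-Reasoning

      missing-some : ∀ u → 2 * k ≤ suc (# (missing? u))
      missing-some u = +-cancelʳ-≤ D _ _ (begin
        2 * k + D                      ≡⟨ trans (+-comm (2 * k) D) (sym C≡) ⟩
        C                              ≤⟨ missing-count u ⟩
        # (missing? u) + suc (dH u)    ≤⟨ +-monoʳ-≤ _ (s≤s (dH≤D u)) ⟩
        # (missing? u) + suc D         ≡⟨ +-suc _ D ⟩
        suc (# (missing? u)) + D       ∎)
        where open ≤-Reasoning

      free-colour : ∃ (Missing κ₀ v)
      free-colour = 1≤#⇒∃ (missing? v) (≤-trans (≤-trans 1≤k (m≤m+n k _)) (missing-many v~w₀ ¬Hvw₀))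

      Lacking : Fin C → Fin N → Set
      Lacking a u = F.Mem u × Missing κ₀ u a

      lacking? : ∀ a → Decidable (Lacking a)
      lacking? a u = F.mem? u ×-dec missing? u a

      -- Let `q = 2k - 1`. The members of the fan together miss at least `q` colours each, plus one
      -- at `w₀`. A colour missing at a member is present at `v`, hence is the colour of `v` or of
      -- an edge to a member. As the edge to `w₀` is uncoloured, there are at most as many such
      -- colours as members, and they cannot all be missing at most `q` times.
      popular : (∀ {u a} → F.Mem u → Missing κ₀ u a → ¬ Missing κ₀ v a) → ∃ λ a → 2 * k ≤ # (lacking? a)
      popular disjoint = decidable-stable (any? (λ a → 2 * k ≤? # (lacking? a))) λ ¬p → <⇒≱ (begin-strict
          q * # F.mem?                                            <⟨ ≤-reflexive (+-comm 1 _) ⟩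
          q * # F.mem? + 1
              ≡⟨ cong₂ _+_ (sum-*ˡ q _) (#-singleton w₀) ⟨
          sum (λ u → q * χ (F.mem? u)) + # (_≟ w₀)                ≡⟨ sum-+ _ _ ⟨
          sum (λ u → q * χ (F.mem? u) + χ (u ≟ w₀))               ≤⟨ sum-mono-≤ lower ⟩
          sum (λ u → # (λ a → lacking? a u))                      ≡⟨ sum-swap _ ⟩
          sum (λ a → # (lacking? a))
              ≤⟨ sum-mono-≤ (upper (λ a h → ¬p (a , h))) ⟩
          sum (λ a → q * (χ (a ≟ φ κ₀ v) + # (used? a)))          ≡⟨ sum-*ˡ q _ ⟩
          q * sum (λ a → χ (a ≟ φ κ₀ v) + # (used? a))            ∎)
        (*-monoʳ-≤ q (begin
          sum (λ a → χ (a ≟ φ κ₀ v) + # (used? a))                ≡⟨ sum-+ _ _ ⟩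
          # (_≟ φ κ₀ v) + sum (λ a → # (used? a))
              ≡⟨ cong₂ _+_ (#-singleton (φ κ₀ v)) (#-fibres fan-edge? (c κ₀ v)) ⟩
          suc (# fan-edge?)
              ≤⟨ #-⊂ fan-edge? F.mem? (λ _ → proj₁) (F.base refl) (¬Hvw₀ ∘ proj₂) ⟩
          # F.mem?                                                ∎))
        where
        open ≤-Reasoning
        q = 2 * k ∸ 1
        2k≡ : 2 * k ≡ suc q
        2k≡ = sym (m+[n∸m]≡n {1} (≤-trans 1≤k (m≤m+n k _)))
        fan-edge? : Decidable (λ u → F.Mem u × H v u)
        fan-edge? u = F.mem? u ×-dec H? v u
        used? : ∀ a → Decidable (λ u → (F.Mem u × H v u) × c κ₀ v u ≡ a)
        used? a u = fan-edge? u ×-dec (c κ₀ v u ≟ a)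
        lower : ∀ u → q * χ (F.mem? u) + χ (u ≟ w₀) ≤ # (λ a → lacking? a u)
        lower u = go (F.mem? u) (u ≟ w₀)
          where
          missing≤ : F.Mem u → # (missing? u) ≤ # (λ a → lacking? a u)
          missing≤ m = #-mono (missing? u) (λ a → lacking? a u) (λ _ → m ,_)
          go : (d : Dec (F.Mem u)) (e : Dec (u ≡ w₀)) → q * χ d + χ e ≤ # (λ a → lacking? a u)
          go (yes m) (yes refl) = ≤-trans (≤-reflexive (trans (cong (_+ 1) (*-identityʳ q))
              (trans (+-comm q 1) (sym 2k≡))))
                                    (≤-trans (missing-many (~-sym v~w₀) (¬Hvw₀ ∘ H-sym)) (missing≤ m))
          go (yes m) (no _) = ≤-trans (≤-reflexive (trans (+-identityʳ _) (*-identityʳ q)))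
                                (≤-trans (s≤s⁻¹ (≤-trans (≤-reflexive (sym 2k≡)) (missing-some u)))
                                    (missing≤ m))
          go (no ¬m) (yes refl) = ⊥-elim (¬m (F.base refl))
          go (no _)  (no _) = ≤-trans (≤-reflexive (trans (+-identityʳ _) (*-zeroʳ q))) z≤n
        upper : (∀ a → ¬ 2 * k ≤ # (lacking? a)) → ∀ a → # (lacking? a) ≤ q * (χ (a ≟ φ κ₀ v) + # (used? a))
        upper ¬p a = go (any? (lacking? a))
          where
          go : Dec (∃ (Lacking a)) → # (lacking? a) ≤ q * (χ (a ≟ φ κ₀ v) + # (used? a))
          go (no ¬w) = ≤-trans (≤-reflexive (#-none (lacking? a) (λ u h → ¬w (u , h)))) z≤n
          go (yes (u , m , miss)) = begin
            # (lacking? a)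
                ≤⟨ s≤s⁻¹ (≤-trans (≰⇒> (¬p a)) (≤-reflexive 2k≡)) ⟩
            q                                              ≡⟨ *-identityʳ q ⟨
            q * 1
                ≤⟨ *-monoʳ-≤ q ([ (λ e → ≤-trans (1≤χ (a ≟ φ κ₀ v) (sym e)) (m≤m+n _ _))
                , (λ { (w , h , refl) → ≤-trans (∈⇒1≤# (used? a) ((F.step (h , miss) m , h) , refl))
                    (m≤n+m _ _) }) ]′
                (not-missing (disjoint m miss))) ⟩
            q * (χ (a ≟ φ κ₀ v) + # (used? a))             ∎

      -- Kempe components with a hub.

      module Kempe (disjoint : ∀ {u a} → F.Mem u → Missing κ₀ u a → ¬ Missing κ₀ v a)
                   {α β} (α-free : Missing κ₀ v α) (β-popular : 2 * k ≤ # (lacking? β)) where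

        E : Fin N → Fin N → Set
        E u w = H u w × (c κ₀ u w ≡ α ⊎ c κ₀ u w ≡ β)

        E? : ∀ u w → Dec (E u w)
        E? u w = H? u w ×-dec ((c κ₀ u w ≟ α) ⊎-dec (c κ₀ u w ≟ β))

        E-sym : ∀ {u w} → E u w → E w u
        E-sym (h , s) = H-sym h , subst (λ a → a ≡ α ⊎ a ≡ β) (c-sym κ₀ h) s

        Pendant : Fin N → Set
        Pendant u = φ κ₀ u ≡ α ⊎ φ κ₀ u ≡ β

        pendant? : Decidable Pendant
        pendant? u = (φ κ₀ u ≟ α) ⊎-dec (φ κ₀ u ≟ β)

        pendants≤2k : # pendant? ≤ 2 * k
        pendants≤2k = ≤-trans (#-cover pendant? (λ u → φ κ₀ u ≟ α) (λ u → φ κ₀ u ≟ β) (λ _ → id))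
          (≤-trans (+-mono-≤ (small κ₀ α) (small κ₀ β)) (≤-reflexive (cong (k +_) (sym (+-identityʳ k)))))

        saturation : ∀ u a → χ (missing? u a) + (# (coloured? u a) + χ (φ κ₀ u ≟ a)) ≤ 1
        saturation u a = go (missing? u a) (φ κ₀ u ≟ a)
          where
          none : (∀ w → H u w → c κ₀ u w ≢ a) → # (coloured? u a) ≡ 0
          none h = #-none (coloured? u a) (λ { w (hw , e) → h w hw e })
          go : (d : Dec (Missing κ₀ u a)) (e : Dec (φ κ₀ u ≡ a)) → χ d + (# (coloured? u a) + χ e) ≤ 1
          go (yes m) (yes e) = ⊥-elim (proj₁ m e)
          go (yes m) (no _)  = ≤-reflexive (cong (λ x → suc (x + 0)) (none (proj₂ m)))
          go (no _) (yes refl) = ≤-reflexive (cong (_+ 1) (none (λ w h → ve κ₀ h)))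
          go (no _) (no _) = ≤-trans (≤-reflexive (+-identityʳ _)) (s≤s⁻¹ (≰⇒> λ two →
            let (x , y , (hx , ex) , (hy , ey) , y≢x) = 2≤#⇒∃₂ (coloured? u a) two in y≢x (ee κ₀ hy hx (trans ey (sym ex)))))

        -- In the graph of α- and β-edges with a pendant half-edge at each vertex coloured α or β, degrees
        -- are at most 2 and each missing colour accounts for one unit of deficiency.
        valency : ∀ u → (χ (missing? u α) + χ (missing? u β)) + (# (E? u) + χ (pendant? u)) ≤ 2
        valency u = begin
          (χ (missing? u α) + χ (missing? u β)) + (# (E? u) + χ (pendant? u))
            ≤⟨ +-monoʳ-≤ (χ (missing? u α) + χ (missing? u β)) (+-mono-≤
                 (#-cover (E? u) (coloured? u α) (coloured? u β)
                     (λ { _ (h , inj₁ e) → inj₁ (h , e) ; _ (h , inj₂ e) → inj₂ (h , e) }))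
                 (χ-cover (pendant? u) (φ κ₀ u ≟ α) (φ κ₀ u ≟ β) id)) ⟩
          (χ (missing? u α) + χ (missing? u β)) + ((# (coloured? u α) + # (coloured? u β)) +
              (χ (φ κ₀ u ≟ α) + χ (φ κ₀ u ≟ β)))
            ≡⟨ regroup (χ (missing? u α)) _ (# (coloured? u α)) _ _ _ ⟩
          (χ (missing? u α) + (# (coloured? u α) + χ (φ κ₀ u ≟ α))) +
              (χ (missing? u β) + (# (coloured? u β) + χ (φ κ₀ u ≟ β)))
            ≤⟨ +-mono-≤ (saturation u α) (saturation u β) ⟩
          2 ∎
          where
          open ≤-Reasoning
          regroup : ∀ a b c d e f → (a + b) + ((c + d) + (e + f)) ≡ (a + (c + e)) + (b + (d + f))
          regroup = solve-∀

        module _ {S : Fin N → Set} (S? : Decidable S) (cl : Closure S E) where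

          module K = Closure cl

          -- Sum `valency` over the component and compare with `closure-edges`, which bounds the
          -- degree sum below by twice the number of members less twice the number of roots. With
          -- all pendants as roots, at most one missing colour per pendant remains; with `v` as the
          -- only root, at most two.
          deficiency : (# (λ u → K.mem? u ×-dec missing? u α) + # (λ u → K.mem? u ×-dec missing? u β))
                         + # (λ u → K.mem? u ×-dec pendant? u) ≤ # S? + # S?
          deficiency = +-cancelˡ-≤ edges _ _ (begin
              edges + ((A + B) + P)                       ≡⟨ regroup edges A B P ⟩
              (A + B) + (edges + P)
                  ≡⟨ trans (sum-+ _ _) (cong₂ _+_ (sum-+ _ _) (sum-+ _ _)) ⟨
              sum (λ u → (χ (K.mem? u ×-dec missing? u α) + χ (K.mem? u ×-dec missing? u β))
                           + (# (λ w → K.mem? u ×-dec E? u w) + χ (K.mem? u ×-dec pendant? u)))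
                                                          ≤⟨ sum-mono-≤ (λ u → bound u (toSum (K.mem? u))) ⟩
              sum (λ u → χ (K.mem? u) + χ (K.mem? u))     ≡⟨ sum-+ _ _ ⟩
              # K.mem? + # K.mem?                         ≤⟨ closure-edges S? E? E-sym cl ⟩
              edges + (# S? + # S?)                       ∎)
            where
            open ≤-Reasoning
            regroup : ∀ e a b p → e + ((a + b) + p) ≡ (a + b) + (e + p)
            regroup = solve-∀
            edges = sum (λ u → # (λ w → K.mem? u ×-dec E? u w))
            A = # (λ u → K.mem? u ×-dec missing? u α)
            B = # (λ u → K.mem? u ×-dec missing? u β)
            P = # (λ u → K.mem? u ×-dec pendant? u)
            bound : ∀ u → K.Mem u ⊎ ¬ K.Mem u → (χ (K.mem? u ×-dec missing? u α) + χ
                (K.mem? u ×-dec missing? u β))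
                           + (# (λ w → K.mem? u ×-dec E? u w) + χ (K.mem? u ×-dec pendant? u)) ≤ χ
                               (K.mem? u) + χ (K.mem? u)
            bound u (inj₁ m) = ≤-trans
              (+-mono-≤ (+-mono-≤ (χ-mono (K.mem? u ×-dec missing? u α) (missing? u α) proj₂)
                  (χ-mono (K.mem? u ×-dec missing? u β) (missing? u β) proj₂))
                        (+-mono-≤ (#-mono (λ w → K.mem? u ×-dec E? u w) (E? u) (λ _ → proj₂))
                            (χ-mono (K.mem? u ×-dec pendant? u) (pendant? u) proj₂)))
              (≤-trans (valency u) (≤-reflexive (sym (cong (λ x → x + x) (χ-yes (K.mem? u) m)))))
            bound u (inj₂ ¬m) = ≤-trans (≤-reflexive (cong₂ _+_
              (cong₂ _+_ (χ-no (K.mem? u ×-dec missing? u α) (¬m ∘ proj₁))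
                  (χ-no (K.mem? u ×-dec missing? u β) (¬m ∘ proj₁)))
              (cong₂ _+_ (#-none (λ w → K.mem? u ×-dec E? u w) (λ _ → ¬m ∘ proj₁))
                  (χ-no (K.mem? u ×-dec pendant? u) (¬m ∘ proj₁))))) z≤n

          -- If all vertices lacking `β` were in the component, the `α` missing at `v` would be one
          -- unit too many for `deficiency`.
          escapes : K.Mem v → # S? + # S? ≤ 2 * k + # (λ u → K.mem? u ×-dec pendant? u) → ∃ λ w →
              Lacking β w × ¬ K.Mem w
          escapes Kv h = decidable-stable (any? (λ w → lacking? β w ×-dec ¬? (K.mem? w))) λ ¬e →
              <⇒≱ (begin-strict
              2 * k + P
                  <⟨ +-monoˡ-< P (≤-refl {suc (2 * k)}) ⟩
              (1 + 2 * k) + P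
                  ≤⟨ +-monoˡ-≤ P (+-mono-≤ (∈⇒1≤# (λ u → K.mem? u ×-dec missing? u α) (Kv , α-free))
                  (≤-trans β-popular (#-mono (lacking? β) (λ u → K.mem? u ×-dec missing? u β)
                    (λ u l → decidable-stable (K.mem? u) (λ ¬m → ¬e (u , l , ¬m)) , proj₂ l)))) ⟩
              (# (λ u → K.mem? u ×-dec missing? u α) + # (λ u → K.mem? u ×-dec missing? u β)) + P
                  ≤⟨ deficiency ⟩
              # S? + # S?                                                 ∎) h
            where
            open ≤-Reasoning
            P = # (λ u → K.mem? u ×-dec pendant? u)

        abstract
          hub-component : Closure Pendant E
          hub-component = closure pendant? E?

          v-component : Closure (_≡ v) E
          v-component = closure (_≟ v) E?

        module Hub = Closure hub-component
        module V = Closure v-component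

        record Separation : Set₁ where
          field
            K      : Fin N → Set
            K?     : Decidable K
            closed : ∀ {u w} → E u w → K u → K w
            v∈K    : K v
            hub    : (∀ u → Pendant u → K u) ⊎ (∀ u → Pendant u → ¬ K u)
            escape : ∃ λ w → Lacking β w × ¬ K w

        -- If v is not connected to the hub, its component is a path without pendants, hence has two ends.
        separation : Separation
        separation = go (Hub.mem? v)
          where
          go : Dec (Hub.Mem v) → Separation
          go (yes m) = record
            { K = Hub.Mem ; K? = Hub.mem? ; closed = λ e →
                Hub.step (E-sym e) ; v∈K = m ; hub = inj₁ (λ u → Hub.base)
            ; escape = escapes pendant? hub-component m (+-mono-≤ pendants≤2k
                (#-mono pendant? (λ u → Hub.mem? u ×-dec pendant? u) (λ u p → Hub.base p , p))) }
          go (no ¬m) = record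
            { K = V.Mem ; K? = V.mem? ; closed = λ e → V.step (E-sym e) ; v∈K = V.base refl
            ; hub = inj₂ (λ u p Vu → V.least (¬_ ∘ Hub.Mem) (λ { refl → ¬m })
                (λ e _ ¬h h → ¬h (Hub.step (E-sym e) h)) Vu (Hub.base p))
            ; escape = escapes (_≟ v) v-component (V.base refl)
                (≤-trans (≤-reflexive (cong (λ x → x + x) (#-singleton v)))
                (≤-trans (*-monoʳ-≤ 2 1≤k) (m≤m+n _ _))) }

        extended : Colouring H⁺
        extended = rotate (<-wellFounded _) (proj₁ (proj₁ (proj₁ (proj₂ first)))) Sw.swapped
            (Sw.missing-outside (λ ¬v → ¬v v∈K) α-free)
            (subst (Missing Sw.swapped _) (Transposition.τ-β α β)
                (Sw.missing-inside (proj₂ (proj₁ (proj₂ first))) (proj₂ (proj₁ (proj₁ (proj₂ first))))))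
            (λ {u} Fu u<w m → keep Fu u<w (K? u) m)
            (λ _ → Sw.c′-outside (λ ¬v → ¬v v∈K))
          where
          open Separation separation
          -- Least rank makes the fan up to this vertex survive the swap: an earlier member outside
          -- `K` misses neither `β`, by minimality, nor `α`, by `disjoint`, so its missing colours
          -- are unaffected.
          first = argmin (λ u → lacking? β u ×-dec ¬? (K? u)) F.rank escape
          -- Swapping on the complement of K leaves the colours at v alone.
          module Sw = Swap H-sym κ₀ α β (λ u → ¬? (K? u)) (λ h s ¬u Kw → ¬u (closed (E-sym (h , s)) Kw))
            ([ (λ h → inj₂ (λ u p ¬u → ¬u (h u p))) , inj₁ ]′ hub)
          keep : ∀ {u a} → F.Mem u → F.rank u < F.rank (proj₁ first) → Dec (K u) → Missing κ₀ u a →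
              Missing Sw.swapped u a
          keep Fu u<w (yes Ku) m = Sw.missing-outside (λ ¬u → ¬u Ku) m
          keep Fu u<w (no ¬Ku) m = Sw.missing-neither (λ mα → disjoint Fu mα α-free)
            (λ mβ → proj₂ (proj₂ first) _ u<w ((Fu , mβ) , ¬Ku)) m

      extend : Colouring H⁺
      extend = go (any? (λ u → any? (λ a → F.mem? u ×-dec (missing? u a ×-dec missing? v a))))
        where
        go : Dec (∃ λ u → ∃ λ a → F.Mem u × Missing κ₀ u a × Missing κ₀ v a) → Colouring H⁺
        go (yes (u , a , m , mu , mv)) = finish m mv mu
        go (no ¬p) = Kempe.extended disjoint (proj₂ free-colour) (proj₂ (popular disjoint))
          where
          disjoint : ∀ {u a} → F.Mem u → Missing κ₀ u a → ¬ Missing κ₀ v a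
          disjoint m mu mv = ¬p (_ , _ , m , mu , mv)

    -- Colouring the edges one by one.

    complete : (φ₀ : Fin N → Fin C) → (∀ {u w} → u ~ w → φ₀ u ≢ φ₀ w) →
        (∀ a → # (λ u → φ₀ u ≟ a) ≤ k) → Colouring _~_
    complete φ₀ vv₀ small₀ = go (λ _ _ → no id) ⊥-elim ⊥-elim
        -- No edge is coloured yet, so `φ₀ u` is only a filler for edge colours.
        (record { φ = φ₀ ; c = λ u _ → φ₀ u ; c-sym = λ () ; vv = vv₀ ; ee = λ () ; ve = λ () ;
            small = small₀ }) (<-wellFounded _)
      where
      missing-edges : {H : Fin N → Fin N → Set} → (∀ u w → Dec (H u w)) → ℕ
      missing-edges H? = sum (λ u → # (λ w → (u ~? w) ×-dec ¬? (H? u w)))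
      go : ∀ {H : Fin N → Fin N → Set} (H? : ∀ u w → Dec (H u w)) → (∀ {u w} → H u w → H w u) →
          (∀ {u w} → H u w → u ~ w) →
           Colouring H → Acc _<_ (missing-edges H?) → Colouring _~_
      go {H} H? H-sym H⊆~ κ (acc rs) = step (any? (λ u → any? (λ w → (u ~? w) ×-dec ¬? (H? u w))))
        where
        step : Dec (∃ λ u → ∃ λ w → u ~ w × ¬ H u w) → Colouring _~_
        step (no ¬p) = restrict (λ {u} {w} a → decidable-stable (H? u w) (λ ¬h → ¬p (u , w , a , ¬h))) κ
        step (yes (v , w , a , ¬h)) = go H⁺? (Sum.map H-sym pair-sym)
            (λ { (inj₁ h) → H⊆~ h ; (inj₂ (inj₁ (refl , refl))) → a ; (inj₂ (inj₂ (refl , refl))) →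
                ~-sym a })
            (Vizing.extend H? H-sym H⊆~ κ a ¬h) (rs fewer)
          where
          H⁺? : ∀ x y → Dec (H x y ⊎ Pair v w x y)
          H⁺? x y = H? x y ⊎-dec pair? v w x y
          fewer : missing-edges H⁺? < missing-edges H?
          fewer = sum-mono-< v
            (λ x → #-mono (λ y → (x ~? y) ×-dec ¬? (H⁺? x y)) (λ y → (x ~? y) ×-dec ¬? (H? x y))
                (λ { y (b , n) → b , n ∘ inj₁ }))
            (#-⊂ (λ y → (v ~? y) ×-dec ¬? (H⁺? v y)) (λ y → (v ~? y) ×-dec ¬? (H? v y))
                (λ { y (b , n) → b , n ∘ inj₁ })
              (a , ¬h) (λ s → proj₂ s (inj₂ (inj₁ (refl , refl)))))

-- Translation to the given definitions and conclusion.

length-filter-tabulate : ∀ {n} {A : Set} {P : A → Set} (P? : Decidable P) (f : Fin n → A) →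
                         length (filter P? (tabulate f)) ≡ # (λ i → P? (f i))
length-filter-tabulate {zero}  P? f = sym (#-none (λ i → P? (f i)) (λ ()))
length-filter-tabulate {suc n} P? f rewrite sum-suc (λ i → χ (P? (f i))) with P? (f zero)
... | yes _ = cong suc (length-filter-tabulate P? (f ∘ suc))
... | no _  = length-filter-tabulate P? (f ∘ suc)
foldr-⊔-tabulate : ∀ {n} (f : Fin n → ℕ) i → f i ≤ foldr _⊔_ 0 (tabulate f)
foldr-⊔-tabulate f zero    = m≤m⊔n _ _
foldr-⊔-tabulate f (suc i) = ≤-trans (foldr-⊔-tabulate (f ∘ suc) i) (m≤n⊔m (f zero) _)

degree≤Δ : ∀ {n} (G : Graph n) u → degree G u ≤ Δ G
degree≤Δ G u = subst (λ l → degree G u ≤ foldr _⊔_ 0 l) (sym (map-tabulate id (degree G)))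
    (foldr-⊔-tabulate (degree G) u)

n≤ceilDivSuc : ∀ n d → n ≤ ceilDivSuc n d * suc d
n≤ceilDivSuc n d = +-cancelʳ-≤ d _ _ (begin
  n + d                                        ≡⟨ m≡m%n+[m/n]*n (n + d) (suc d) ⟩
  (n + d) % suc d + ceilDivSuc n d * suc d     ≤⟨ +-monoˡ-≤ _ (s≤s⁻¹ (m%n<n (n + d) (suc d))) ⟩
  d + ceilDivSuc n d * suc d                   ≡⟨ +-comm d _ ⟩
  ceilDivSuc n d * suc d + d                   ∎)
  where open ≤-Reasoning

theorem1 : (n : ℕ) (G : Graph n) →
    TotallyColorable G (Δ G + 2 * ceilDivSuc n (Δ G))
theorem1 n G with n≤ceilDivSuc n (Δ G)
-- Without vertices the ceiling is 0 and `1≤k` would fail.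
theorem1 zero G | _ = record
  { vcol = λ () ; ecol = λ () ; ecol-sym = λ () ; vv = λ () ; ee = λ () ; ve = λ () }
theorem1 (suc m) G | n≤ with ceilDivSuc (suc m) (Δ G)
... | k = record
  { vcol = φ
  ; ecol = λ u v _ → c u v
  ; ecol-sym = λ u v p _ → c-sym p
  ; vv = λ u v → vv
  ; ee = λ u v w p q v≢w e → v≢w (ee p q e)
  ; ve = λ u v → ve
  }
  where
  n = suc m
  D = Δ G
  C = D + 2 * k

  adj? : ∀ u v → Dec (Adj G u v)
  adj? u v = Bool.T? (adj G u v)

  adj-sym : ∀ {u v} → Adj G u v → Adj G v u
  adj-sym {u} {v} = subst IsTrue (Graph.sym G u v)

  adj-irrefl : ∀ {u} → ¬ Adj G u u
  adj-irrefl {u} a = subst IsTrue (irrefl G u) a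

  degree≤D : ∀ u → # (adj? u) ≤ D
  degree≤D u = ≤-trans (≤-reflexive (sym (length-filter-tabulate (λ v → adj? u v) id))) (degree≤Δ G u)

  1≤k : 1 ≤ k
  1≤k = n≢0⇒n>0 λ { refl → n≮0 n≤ }

  D<C : D < C
  D<C = ≤-trans (≤-reflexive (+-comm 1 D)) (+-monoʳ-≤ D (≤-trans 1≤k (m≤m+n k _)))

  everyVertex? : Decidable {A = Fin n} (λ _ → ⊤)
  everyVertex? _ = yes tt

  everyColour? : Decidable {A = Fin C} (λ _ → ⊤)
  everyColour? _ = yes tt

  #everyColour : # everyColour? ≡ C
  #everyColour = trans (sum-const C 1) (*-identityʳ C)

  open HajnalSzemerédi {n} {C} k (Adj G) adj? adj-sym adj-irrefl using (Proper; hajnal-szemerédi)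

  -- Vertices draw on the same `C` colours as edges. The degree condition is `Δ < C`; the class
  -- bound comes from `n ≤ k * (Δ + 1)`, the one fact retained about the ceiling.
  equitable : ∃ (Proper everyVertex? (λ _ → ⊤))
  equitable = hajnal-szemerédi (λ _ → fromℕ< D<C) everyVertex? everyColour?
    (begin
      # everyVertex?       ≤⟨ #-≤ everyVertex? ⟩
      n                    ≤⟨ n≤ ⟩
      k * suc D            ≤⟨ *-monoʳ-≤ k D<C ⟩
      k * C                ≡⟨ cong (k *_) #everyColour ⟨
      k * # everyColour?   ∎)
    (λ {x} _ → ≤-<-trans (#-mono (λ y → adj? x y ×-dec everyVertex? y) (adj? x) (λ _ → proj₁))
       (≤-<-trans (degree≤D x) (<-≤-trans D<C (≤-reflexive (sym #everyColour)))))
    where open ≤-Reasoning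

  open Proper (proj₂ equitable)

  open TotalColourings {n} {C} k (Adj G) adj? adj-sym adj-irrefl using (module Colouring; module Extension)

  open Colouring (Extension.complete D degree≤D 1≤k refl
    (proj₁ equitable) (proper tt tt)
    (λ a → ≤-trans (#-mono (λ u → proj₁ equitable u ≟ a)
        (λ u → everyVertex? u ×-dec (proj₁ equitable u ≟ a)) (λ _ → tt ,_)) (bounded a)))
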